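{- Let $G$ be a graph. Then $G$ is bipartite and has rank-width at most $1$ if and only if $G$ is a pivot-minor of a tree.
   Context: All graphs are finite, simple and undirected. Local complementation at $v$ in $G=(V,E)$ gives $G*v=(V,E\,\Delta\,\{xy:xv,yv\in E,x\ne y\})$; pivoting an edge $uv$ gives $G\wedge uv=G*u*v*u$; a pivot-minor of $G$ is a graph obtained from $G$ by a sequence of vertex deletions and pivotings of edges. Rank-width: with $A(G)$ the adjacency matrix over $GF(2)$, the cut-rank of $X\subseteq V(G)$ is the rank of the submatrix of $A(G)$ with rows $X$ and columns $V(G)\setminus X$; a subcubic tree is a tree with at least two vertices in which every non-leaf vertex has degree $3$; a rank-decomposition is a pair $(T,L)$ with $T$ subcubic and $L$ a bijection from $V(G)$ to the leaves of $T$, an edge $e$ of $T$ having width equal to the cut-rank of $L^{ -1}(X_e)$ where $X_e$ is the leaf set of a component of $T\setminus e$; the rank-width of $G$ is the minimum over rank-decompositions of the maximum edge width, and is $0$ if $|V(G)|\le 1$. -}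

module Defs where

open import Data.Nat using (ℕ; zero; suc; _+_; _≤_)
open import Data.Fin using (Fin; zero; suc; punchIn; inject₁; fromℕ; _≟_)
open import Data.Bool using (Bool; true; false; not; _∧_; _xor_; if_then_else_)
open import Data.Product using (Σ; ∃; _×_; _,_)
open import Data.Sum using (_⊎_)
open import Relation.Nullary using (¬_; does)
open import Relation.Binary.PropositionalEquality using (_≡_; _≢_)
open import Function.Bundles using (_↔_; Inverse)
open import Function.Definitions using (Injective)

-- A graph on the vertex set Fin n, given by its adjacency relation
-- (= adjacency matrix over GF(2), true = 1).
Adj : ℕ → Set
Adj n = Fin n → Fin n → Bool

IsSimple : ∀ {n} → Adj n → Set
IsSimple {n} A = (∀ (x y : Fin n) → A x y ≡ A y x) × (∀ (x : Fin n) → A x x ≡ false)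

lc : ∀ {n} → Adj n → Fin n → Adj n
lc A v x y = if does (x ≟ y) then A x y else (A x y xor (A x v ∧ A y v))

pivot : ∀ {n} → Adj n → Fin n → Fin n → Adj n
pivot A u v = lc (lc (lc A u) v) u

delete : ∀ {n} → Adj (suc n) → Fin (suc n) → Adj n
delete A v x y = A (punchIn v x) (punchIn v y)

Iso : ∀ {m n} → Adj m → Adj n → Set
Iso {m} {n} H G = Σ (Fin m ↔ Fin n) λ f →
  ∀ x y → H x y ≡ G (Inverse.to f x) (Inverse.to f y)

data PivotMinor {m : ℕ} (H : Adj m) : ∀ {n} → Adj n → Set where
  pm-iso : ∀ {n} {G : Adj n} → Iso H G → PivotMinor H G
  pm-del : ∀ {n} {G : Adj (suc n)} (v : Fin (suc n)) →
           PivotMinor H (delete G v) → PivotMinor H G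
  pm-piv : ∀ {n} {G : Adj n} (u v : Fin n) → G u v ≡ true →
           PivotMinor H (pivot G u v) → PivotMinor H G

data Walk {n} (A : Adj n) : Fin n → Fin n → Set where
  here : ∀ {x} → Walk A x x
  step : ∀ {x z y} → A x z ≡ true → Walk A z y → Walk A x y

Connected : ∀ {n} → Adj n → Set
Connected {n} A = ∀ (x y : Fin n) → Walk A x y

HasCycle : ∀ {n} → Adj n → Set
HasCycle {n} A = Σ ℕ λ k → Σ (Fin (suc (suc (suc k))) → Fin n) λ c →
  Injective _≡_ _≡_ c ×
  (∀ (i : Fin (suc (suc k))) → A (c (inject₁ i)) (c (suc i)) ≡ true) ×
  (A (c (fromℕ (suc (suc k)))) (c zero) ≡ true)

-- a tree: (nonempty — vertex set Fin (suc m)) connected acyclic simple graph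
IsTree : ∀ {n} → Adj n → Set
IsTree A = IsSimple A × Connected A × ¬ HasCycle A

Bipartite : ∀ {n} → Adj n → Set
Bipartite {n} A = Σ (Fin n → Bool) λ col →
  ∀ (x y : Fin n) → A x y ≡ true → col x ≢ col y

xorSum : ∀ {k} → (Fin k → Bool) → Bool
xorSum {zero} f = false
xorSum {suc k} f = f zero xor xorSum (λ i → f (suc i))

-- CutRankAtMost A k X : the submatrix of A with rows X and columns V∖X
-- has GF(2)-rank at most k, i.e. any k+1 distinct rows of it are
-- linearly dependent (rank = maximum number of linearly independent rows).
CutRankAtMost : ∀ {n} → Adj n → ℕ → (Fin n → Set) → Set
CutRankAtMost {n} A k X =
  ∀ (r : Fin (suc k) → Fin n) → Injective _≡_ _≡_ r → (∀ i → X (r i)) →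
  Σ (Fin (suc k) → Bool) λ c → (Σ (Fin (suc k)) λ i → c i ≡ true) ×
    (∀ (y : Fin n) → ¬ X y → xorSum (λ i → c i ∧ A (r i) y) ≡ false)

count : ∀ {k} → (Fin k → Bool) → ℕ
count {zero} f = zero
count {suc k} f = (if f zero then 1 else 0) + count (λ i → f (suc i))

degree : ∀ {t} → Adj t → Fin t → ℕ
degree T v = count (T v)

IsLeaf : ∀ {t} → Adj t → Fin t → Set
IsLeaf T v = degree T v ≡ 1

IsSubcubicTree : ∀ {t} → Adj t → Set
IsSubcubicTree {t} T = 2 ≤ t × IsTree T ×
  (∀ (v : Fin t) → ¬ IsLeaf T v → degree T v ≡ 3)

removeEdge : ∀ {t} → Adj t → Fin t → Fin t → Adj t
removeEdge T u v x y =
  if (does (x ≟ u) ∧ does (y ≟ v)) then false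
  else if (does (x ≟ v) ∧ does (y ≟ u)) then false
  else T x y

record RankDecomposition (n : ℕ) : Set where
  field
    t        : ℕ
    T        : Adj t
    subcubic : IsSubcubicTree T
    L        : Fin n → Fin t
    L-inj    : Injective _≡_ _≡_ L
    L-leaf   : ∀ x → IsLeaf T (L x)
    L-onto   : ∀ v → IsLeaf T v → Σ (Fin n) λ x → L x ≡ v

WidthAtMost : ∀ {n} → Adj n → RankDecomposition n → ℕ → Set
WidthAtMost A D k =
  ∀ u v → T u v ≡ true →
    CutRankAtMost A k (λ x → Walk (removeEdge T u v) u (L x))
  where open RankDecomposition D

-- rank-width ≤ k (rank-width is 0 when |V(G)| ≤ 1)
RankWidthAtMost : ∀ {n} → Adj n → ℕ → Set
RankWidthAtMost {n} A k = n ≤ 1 ⊎ Σ (RankDecomposition n) λ D → WidthAtMost A D k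

{-# OPTIONS --safe #-}
module Submission where

-- Both conditions say that G is built from at most one vertex by repeatedly adding an isolated
-- vertex, a pendant vertex at some y, or a false twin of some y. The row of the new vertex is
-- α δ_y + β A_y, a shape kept by local complementations; pivoting an edge at y exchanges α and β,
-- pivoting an edge away from y keeps them.
--  * Built graphs are therefore closed under pivots, and under deletions; forests are built, as they
--    have vertices of degree at most 1. This gives that pivot-minors of trees are built.
--  * A built graph is a pivot-minor of a tree: if H is a pivot-minor of K, then H with a vertex
--    attached at y is one of K with a vertex attached at some y′, and a tree with an attached
--    vertex is a pivot-minor of the same tree with a path of length two hung at y′.
--  * A decomposition of width 1 is extended to the new vertex by splitting the leaf of y in two.
--  * Conversely the leaves of a decomposition of width 1 are contracted into their neighbours. When
--    two labels x, y meet, the cut {x, y} has rank at most 1, so x or y is isolated, pendant or a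
--    twin in G; a true twin with a further neighbour would give a triangle.

open import Defs
open import Data.Nat using (ℕ; zero; suc; _+_; _≤_; _<_; z≤n; s≤s; s≤s⁻¹)
import Data.Nat.Properties as ℕ
open import Data.Fin using (Fin; zero; suc; punchIn; punchOut; inject₁; fromℕ; toℕ; _≟_)
open import Data.Fin.Properties
  using (suc-injective; punchIn-injective; punchInᵢ≢i; punchIn-punchOut; any?; injective⇒≤;
         toℕ-injective; toℕ-inject₁; toℕ-fromℕ; toℕ<n)
open import Data.Fin.Relation.Unary.Top using (view; ‵fromℕ; ‵inject₁)
open import Data.Fin.Permutation as Perm using (Permutation; _⟨$⟩ʳ_; _⟨$⟩ˡ_; inverseˡ; inverseʳ; punchIn-permute)
open import Data.Bool using (Bool; true; false; _∧_; _∨_; _xor_; if_then_else_)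
import Data.Bool.Properties as Bool
open import Data.Product using (Σ; ∃; _×_; _,_; proj₁; proj₂; swap)
open import Data.Sum using (_⊎_; inj₁; inj₂)
open import Data.Empty using (⊥; ⊥-elim)
open import Function using (_∘_; id; case_of_)
open import Function.Definitions using (Injective)
open import Function.Bundles using (_⇔_; mk⇔)
open import Relation.Nullary using (¬_; Dec; yes; no; does; ¬?)
open import Relation.Nullary.Decidable
  using (True; toWitness; dec-true; dec-false; map′; _×-dec_; decidable-stable)
open import Relation.Binary.PropositionalEquality
  using (_≡_; _≢_; refl; sym; trans; cong; cong₂; subst; subst₂)

-- Boolean identities by truth table, and first facts on local complementation

Op : ℕ → Set
Op zero    = Bool
Op (suc k) = Bool → Op k

Agree : ∀ k → Op k → Op k → Set
Agree zero    f g = f ≡ g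
Agree (suc k) f g = ∀ b → Agree k (f b) (g b)

agree? : ∀ k f g → Dec (Agree k f g)
agree? zero    f g = f Bool.≟ g
agree? (suc k) f g =
  map′ (λ { (p , q) false → p ; (p , q) true → q }) (λ h → h false , h true)
       (agree? k (f false) (g false) ×-dec agree? k (f true) (g true))

-- Evaluation at all arguments decides the identity, so the implicit `True` argument is solved by
-- computation and a use only displays the two sides.
truthTable : ∀ k f g {_ : True (agree? k f g)} → Agree k f g
truthTable k f g {t} = toWitness t

true≢false : true ≢ false
true≢false ()

variable
  m n : ℕ

infix 4 _≈_
_≈_ : Adj n → Adj n → Set
A ≈ B = ∀ a b → A a b ≡ B a b

≢-adjacent : ∀ {A : Adj n} → IsSimple A → ∀ {u v} → A u v ≡ true → u ≢ v
≢-adjacent (_ , irr) {u} e refl = true≢false (trans (sym e) (irr u))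

lc-off : ∀ (A : Adj n) v {a b} → a ≢ b → lc A v a b ≡ A a b xor (A a v ∧ A b v)
lc-off A v {a} {b} a≢b rewrite dec-false (a ≟ b) a≢b = refl

lc-diag : ∀ (A : Adj n) v a → lc A v a a ≡ A a a
lc-diag A v a rewrite dec-true (a ≟ a) refl = refl

lc-cong : ∀ {A B : Adj n} → A ≈ B → ∀ v → lc A v ≈ lc B v
lc-cong p v a b rewrite p a b | p a v | p b v = refl

lc-simple : ∀ {A : Adj n} → IsSimple A → ∀ v → IsSimple (lc A v)
lc-simple {A = A} (s , i) v = sy , λ x → trans (lc-diag A v x) (i x)
  where
  sy : ∀ x y → lc A v x y ≡ lc A v y x
  sy x y with x ≟ y
  ... | yes refl = sym (lc-diag A v x)
  ... | no x≢y = trans (cong₂ _xor_ (s x y) (Bool.∧-comm (A x v) (A y v))) (sym (lc-off A v (x≢y ∘ sym)))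

pivot-simple : ∀ {A : Adj n} → IsSimple A → ∀ u v → IsSimple (pivot A u v)
pivot-simple s u v = lc-simple (lc-simple (lc-simple s u) v) u

-- Local complementation and attached vertices

add : Adj n → (Fin n → Bool) → Adj (suc n)
add H f zero    zero    = false
add H f zero    (suc b) = f b
add H f (suc a) zero    = f a
add H f (suc a) (suc b) = H a b

add-simple : ∀ {H : Adj n} → IsSimple H → ∀ f → IsSimple (add H f)
add-simple (s , i) f =
  (λ { zero zero → refl ; zero (suc _) → refl ; (suc _) zero → refl ; (suc a) (suc b) → s a b }) ,
  (λ { zero → refl ; (suc a) → i a })

add-cong : ∀ {H K : Adj n} {f g : Fin n → Bool} → H ≈ K → (∀ b → f b ≡ g b) → add H f ≈ add K g
add-cong p q zero    zero    = refl
add-cong p q zero    (suc b) = q b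
add-cong p q (suc a) zero    = q a
add-cong p q (suc a) (suc b) = p a b

-- The coefficients (1,0), (0,1) and (0,0) give a pendant vertex at y, a (false) twin of y and an
-- isolated vertex. The pair (1,1), a true twin, only occurs between the local complementations of a pivot.
row : Adj n → Fin n → Bool × Bool → Fin n → Bool
row H y (α , β) b = (α ∧ does (b ≟ y)) xor (β ∧ H y b)

extend : Adj n → Fin n → Bool × Bool → Adj (suc n)
extend H y c = add H (row H y c)

turn : Adj n → Fin n → Fin n → Bool × Bool → Bool × Bool
turn H u y (α , β) = if does (u ≟ y) then (α , α xor β) else (α xor (β ∧ H y u) , β)

-- Complementing at `u` adds `f u` times the column of `u` to a row `f`. If `u = y`, the row of `y`
-- does not change and `f y = α`, so `β` becomes `α xor β`. If `u ≠ y`, then `f u = β ∧ H y u`, and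
-- the row of `y` in `lc H u` is `H y` plus `H y u` times that column, except that its diagonal
-- entry stays `false`; this correction at `y` is what `α` absorbs.
row-lc : ∀ {H : Adj n} → IsSimple H → ∀ u y c b →
         row H y c b xor (row H y c u ∧ H b u) ≡ row (lc H u) y (turn H u y c) b
row-lc {H = H} (s , i) u y (α , β) b with u ≟ y | b ≟ y
... | yes refl | yes refl rewrite lc-diag H y y | i y =
  truthTable 2 (λ α β → (α ∧ true xor β ∧ false) xor ((α ∧ true xor β ∧ false) ∧ false))
               (λ α β → α ∧ true xor (α xor β) ∧ false) α β
... | yes refl | no b≢y rewrite lc-off H y (b≢y ∘ sym) | i y | s b y =
  truthTable 3 (λ α β h → (α ∧ false xor β ∧ h) xor ((α ∧ true xor β ∧ false) ∧ h))
               (λ α β h → α ∧ false xor (α xor β) ∧ (h xor (false ∧ h))) α β (H y b)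
... | no u≢y | yes refl rewrite lc-diag H u y | i y =
  truthTable 3 (λ α β h → (α ∧ true xor β ∧ false) xor ((α ∧ false xor β ∧ h) ∧ h))
               (λ α β h → (α xor (β ∧ h)) ∧ true xor β ∧ false) α β (H y u)
... | no u≢y | no b≢y rewrite lc-off H u (b≢y ∘ sym) =
  truthTable 5 (λ α β h k l → (α ∧ false xor β ∧ k) xor ((α ∧ false xor β ∧ h) ∧ l))
               (λ α β h k l → (α xor (β ∧ h)) ∧ false xor β ∧ (k xor h ∧ l)) α β (H y u) (H y b) (H b u)

lc-add : ∀ (H : Adj n) f u → lc (add H f) (suc u) ≈ add (lc H u) (λ b → f b xor (f u ∧ H b u))
lc-add H f u zero    zero    = refl
lc-add H f u zero    (suc b) = refl
lc-add H f u (suc a) zero    = cong (f a xor_) (Bool.∧-comm (H a u) (f u))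
lc-add H f u (suc a) (suc b) = refl

≈-trans : ∀ {A B C : Adj n} → A ≈ B → B ≈ C → A ≈ C
≈-trans p q a b = trans (p a b) (q a b)

≈-sym : ∀ {A B : Adj n} → A ≈ B → B ≈ A
≈-sym p a b = sym (p a b)

lc-extend : ∀ {H : Adj n} → IsSimple H → ∀ u y c →
            lc (extend H y c) (suc u) ≈ extend (lc H u) y (turn H u y c)
lc-extend {H = H} si u y c =
  ≈-trans (lc-add H (row H y c) u) (add-cong (λ _ _ → refl) (row-lc si u y c))

onEdge : Fin n → Fin n → Fin n → Bool
onEdge u v y = if does (u ≟ y) then true else does (v ≟ y)

pivoted : Fin n → Fin n → Fin n → Bool × Bool → Bool × Bool
pivoted u v y c = if onEdge u v y then swap c else c

-- For `y` on the edge the three turns act on `(α , β)` as alternating transvections over GF(2),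
-- whose product is the swap. For any other `y`, with `h = H y u` and `k = H y v`, they add `β`
-- times `h`, `h + k` and `k` to `α`, which cancels.
turn³ : ∀ {H : Adj n} → IsSimple H → ∀ u v → H u v ≡ true → ∀ y c →
        turn (lc (lc H u) v) u y (turn (lc H u) v y (turn H u y c)) ≡ pivoted u v y c
turn³ {H = H} si@(s , i) u v e y (α , β) with u ≟ y | v ≟ y
... | yes refl | yes refl = ⊥-elim (≢-adjacent si e refl)
... | yes refl | no v≢u rewrite lc-off H u (v≢u ∘ sym) | e | i u =
  cong₂ _,_ (truthTable 2 (λ α β → α xor (α xor β) ∧ true) (λ α β → β) α β)
            (truthTable 2 (λ α β → (α xor ((α xor β) ∧ true)) xor (α xor β)) (λ α β → α) α β)
... | no u≢v | yes refl
  rewrite lc-off (lc H u) v (u≢v ∘ sym) | lc-off H u (u≢v ∘ sym) | lc-diag H u v | i v | i u | s v u | e =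
  cong₂ _,_ (truthTable 2 (λ α β → (α xor β ∧ true) xor ((α xor β ∧ true) xor β) ∧ true) (λ α β → β) α β)
            (truthTable 2 (λ α β → (α xor β ∧ true) xor β) (λ α β → α) α β)
... | no u≢y | no v≢y
  rewrite lc-off (lc H u) v (u≢y ∘ sym) | lc-off H u (u≢y ∘ sym) | lc-off H u (v≢y ∘ sym)
        | lc-off H u (≢-adjacent si e) | i u | s v u | e =
  cong (_, β) (truthTable 4 (λ α β h k → ((α xor β ∧ h) xor β ∧ (k xor h ∧ true)) xor
                                  β ∧ ((h xor h ∧ false) xor (k xor h ∧ true) ∧ true))
                            (λ α β h k → α) α β (H y u) (H y v))

pivot-extend : ∀ {H : Adj n} → IsSimple H → ∀ u v → H u v ≡ true → ∀ y c →
               pivot (extend H y c) (suc u) (suc v) ≈ extend (pivot H u v) y (pivoted u v y c)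
pivot-extend {H = H} si u v e y c =
  subst (λ d → pivot (extend H y c) (suc u) (suc v) ≈ extend (pivot H u v) y d) (turn³ si u v e y c)
    (≈-trans (lc-cong (lc-cong (lc-extend si u y c) (suc v)) (suc u))
    (≈-trans (lc-cong (lc-extend s₁ v y c₁) (suc u))
             (lc-extend (lc-simple s₁ v) u y (turn (lc H u) v y c₁))))
  where
  s₁ = lc-simple si u
  c₁ = turn H u y c

-- Relabelling

Preserves : Permutation m n → Adj m → Adj n → Set
Preserves f H G = ∀ x y → H x y ≡ G (f ⟨$⟩ʳ x) (f ⟨$⟩ʳ y)

≈⇒Iso : ∀ {A B : Adj n} → A ≈ B → Iso A B
≈⇒Iso p = Perm.id , p

Iso-trans : ∀ {k} {A : Adj m} {B : Adj n} {C : Adj k} → Iso A B → Iso B C → Iso A C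
Iso-trans (f , p) (g , q) = f Perm.∘ₚ g , λ x y → trans (p x y) (q _ _)

Iso-sym : ∀ {A : Adj m} {B : Adj n} → Iso A B → Iso B A
Iso-sym {B = B} (f , p) = Perm.flip f , λ x y →
  trans (cong₂ B (sym (inverseʳ f)) (sym (inverseʳ f))) (sym (p _ _))

perm-injective : ∀ (f : Permutation m n) → Injective _≡_ _≡_ (f ⟨$⟩ʳ_)
perm-injective f e = trans (sym (inverseˡ f)) (trans (cong (f ⟨$⟩ˡ_) e) (inverseˡ f))

does-≟-injective : ∀ (f : Fin m → Fin n) → Injective _≡_ _≡_ f → ∀ a b → does (f a ≟ f b) ≡ does (a ≟ b)
does-≟-injective f inj a b with a ≟ b
... | yes a≡b = dec-true (f a ≟ f b) (cong f a≡b)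
... | no a≢b  = dec-false (f a ≟ f b) (a≢b ∘ inj)

simple-relabel : ∀ {A : Adj m} {B : Adj n} → Iso A B → IsSimple B → IsSimple A
simple-relabel (f , p) (s , i) = (λ x y → trans (p x y) (trans (s _ _) (sym (p y x)))) , λ x → trans (p x x) (i _)

lc-preserves : ∀ (f : Permutation m n) {H G} → Preserves f H G → ∀ v → Preserves f (lc H v) (lc G (f ⟨$⟩ʳ v))
lc-preserves f p v x y
  rewrite p x y | p x v | p y v | does-≟-injective (f ⟨$⟩ʳ_) (perm-injective f) x y = refl

pivot-preserves : ∀ (f : Permutation m n) {H G} → Preserves f H G → ∀ u v →
                  Preserves f (pivot H u v) (pivot G (f ⟨$⟩ʳ u) (f ⟨$⟩ʳ v))
pivot-preserves f {H} {G} p u v =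
  lc-preserves f {lc (lc H u) v} {lc (lc G u′) v′} (lc-preserves f {lc H u} {lc G u′} (lc-preserves f {H} {G} p u) v) u
  where
  u′ = f ⟨$⟩ʳ u
  v′ = f ⟨$⟩ʳ v

delete-Iso : ∀ {G : Adj (suc m)} {H : Adj (suc n)} (φ : Iso G H) v →
             Iso (delete G v) (delete H (proj₁ φ ⟨$⟩ʳ v))
delete-Iso {H = H} (f , p) v = Perm.remove v f , λ x y →
  trans (p _ _) (cong₂ H (punchIn-permute f v x) (punchIn-permute f v y))

delete-simple : ∀ {G : Adj (suc n)} → IsSimple G → ∀ v → IsSimple (delete G v)
delete-simple (s , i) v = (λ x y → s _ _) , λ x → i _

extend-Iso : ∀ {H : Adj m} {K : Adj n} (φ : Iso H K) y c → Iso (extend H y c) (extend K (proj₁ φ ⟨$⟩ʳ y) c)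
extend-Iso {H = H} {K} (f , p) y c@(α , β) = Perm.lift₀ f , λ
  { zero zero → refl ; zero (suc b) → r b ; (suc a) zero → r a ; (suc a) (suc b) → p a b }
  where
  r : ∀ b → row H y c b ≡ row K (f ⟨$⟩ʳ y) c (f ⟨$⟩ʳ b)
  r b rewrite p y b | does-≟-injective (f ⟨$⟩ʳ_) (perm-injective f) b y = refl

row-delete : ∀ (H : Adj (suc n)) v {y y′} → punchIn v y′ ≡ y → ∀ c b →
             row H y c (punchIn v b) ≡ row (delete H v) y′ c b
row-delete H v {y′ = y′} refl (α , β) b
  rewrite does-≟-injective (punchIn v) (λ {a} {b} → punchIn-injective v a b) b y′ = refl

delete-add : ∀ (H : Adj (suc n)) f v → delete (add H f) (suc v) ≈ add (delete H v) (f ∘ punchIn v)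
delete-add H f v zero    zero    = refl
delete-add H f v zero    (suc b) = refl
delete-add H f v (suc a) zero    = refl
delete-add H f v (suc a) (suc b) = refl

-- The equation names `y` after the deletion and at the same time says that `v` is not `y`.
delete-extend : ∀ (H : Adj (suc n)) v {y y′} → punchIn v y′ ≡ y → ∀ c →
                delete (extend H y c) (suc v) ≈ extend (delete H v) y′ c
delete-extend H v e c = ≈-trans (delete-add H _ v) (add-cong (λ _ _ → refl) (row-delete H v e c))

-- Lets an arbitrary vertex be regarded as the attached one, which `add` always places at `zero`.
bringToFront : ∀ {G : Adj (suc n)} → IsSimple G → ∀ x → Iso (add (delete G x) (G x ∘ punchIn x)) G
bringToFront {G = G} (s , i) x = f , λ
  { zero    zero    → sym (i x)
  ; zero    (suc b) → cong (G x) (sym (fs b))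
  ; (suc a) zero    → trans (s x _) (cong (λ z → G z x) (sym (fs a)))
  ; (suc a) (suc b) → cong₂ G (sym (fs a)) (sym (fs b)) }
  where
  f = Perm.insert zero x Perm.id
  fs : ∀ b → f ⟨$⟩ʳ suc b ≡ punchIn x b
  fs = Perm.insert-punchIn zero x Perm.id

-- Exchanging the attached vertex with `y`; pivots of a pendant edge

exchange : Fin n → Fin (suc n) → Fin (suc n)
exchange y zero    = suc y
exchange y (suc b) = if does (b ≟ y) then zero else suc b

exchange-hit : ∀ (y : Fin n) → exchange y (suc y) ≡ zero
exchange-hit y rewrite dec-true (y ≟ y) refl = refl

exchange-miss : ∀ {y b : Fin n} → b ≢ y → exchange y (suc b) ≡ suc b
exchange-miss {y = y} {b} b≢y rewrite dec-false (b ≟ y) b≢y = refl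

exchange-involutive : ∀ (y : Fin n) b → exchange y (exchange y b) ≡ b
exchange-involutive y zero = exchange-hit y
exchange-involutive y (suc b) with b ≟ y
... | yes refl = refl
... | no b≢y   = exchange-miss b≢y

exchangeₚ : Fin n → Permutation (suc n) (suc n)
exchangeₚ y = Perm.permutation (exchange y) (exchange y) (exchange-involutive y) (exchange-involutive y)

pendant twin isolated : Bool × Bool
pendant  = true , false
twin     = false , true
isolated = false , false

-- Carries a pivot at the new twin over to a pivot at `y`, which takes place within the old graph.
twin-automorphism : ∀ {H : Adj n} → IsSimple H → ∀ y →
                    Preserves (exchangeₚ y) (extend H y twin) (extend H y twin)
twin-automorphism (s , i) y zero zero = sym (i y)
twin-automorphism (s , i) y zero (suc b) with b ≟ y
... | yes refl = refl
... | no _     = refl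
twin-automorphism (s , i) y (suc a) zero with a ≟ y
... | yes refl = refl
... | no _     = s y a
twin-automorphism (s , i) y (suc a) (suc b) with a ≟ y | b ≟ y
... | yes refl | yes refl = i a
... | yes refl | no _     = refl
... | no _     | yes refl = s a b
... | no _     | no _     = refl

-- The hypothesis says that `v` has at most one neighbour, so there is no pair to toggle.
lc-leaf : ∀ {A : Adj n} v → (∀ a b → a ≢ b → A a v ∧ A b v ≡ false) → lc A v ≈ A
lc-leaf {A = A} v h a b with a ≟ b
... | yes _  = refl
... | no a≢b rewrite h a b a≢b = Bool.xor-identityʳ (A a b)

pendant-leaf : ∀ (H : Adj n) y a b → a ≢ b → extend H y pendant a zero ∧ extend H y pendant b zero ≡ false
pendant-leaf H y zero    b       a≢b = refl
pendant-leaf H y (suc a) zero    a≢b = Bool.∧-zeroʳ _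
pendant-leaf H y (suc a) (suc b) a≢b with a ≟ y | b ≟ y
... | yes refl | yes refl = ⊥-elim (a≢b refl)
... | yes refl | no _     = refl
... | no _     | _        = refl

turn-self : ∀ (H : Adj n) y → turn H y y pendant ≡ (true , true)
turn-self H y rewrite dec-true (y ≟ y) refl = refl

-- The core of a pivot of the pendant edge. Started at `zero`, the pivot has one complementation
-- before it, and started at `suc y` one after it; each of these is at a vertex that is a leaf at
-- that moment and has no effect.
lc² : Adj n → Fin n → Adj (suc n)
lc² H y = lc (lc (extend H y pendant) (suc y)) zero

-- The first complementation makes the new vertex a true twin of `y`. The second restores the edges
-- among the neighbours of `y` and cuts `y` off from them, so that `y` is left pendant at the new
-- vertex, which has taken its place.
lc²-preserves : ∀ {H : Adj n} → IsSimple H → ∀ y → Preserves (exchangeₚ y) (lc² H y) (extend H y pendant)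
lc²-preserves {n} {H} si@(s , i) y a b = trans (lc-cong eq zero a b) (N a b)
  where
  K = lc H y
  eq : lc (extend H y pendant) (suc y) ≈ extend K y (true , true)
  eq = subst (λ c → lc (extend H y pendant) (suc y) ≈ extend K y c) (turn-self H y) (lc-extend si y y pendant)
  fʸ : row K y (true , true) y ≡ true
  fʸ rewrite dec-true (y ≟ y) refl | i y = refl
  fᵒ : ∀ {b} → b ≢ y → row K y (true , true) b ≡ H y b
  fᵒ {b} b≢y rewrite dec-false (b ≟ y) b≢y | lc-off H y (b≢y ∘ sym) | i y = Bool.xor-identityʳ (H y b)
  N₀ : ∀ b → row K y (true , true) b ≡ extend H y pendant (suc y) (exchange y (suc b))
  N₀ b with b ≟ y
  ... | yes refl rewrite dec-true (b ≟ b) refl | i b = refl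
  ... | no b≢y rewrite lc-off H y (b≢y ∘ sym) | i y = Bool.xor-identityʳ (H y b)
  symE = proj₁ (add-simple si (row H y pendant))
  N : Preserves (exchangeₚ y) (lc (extend K y (true , true)) zero) (extend H y pendant)
  N zero zero = sym (i y)
  N zero (suc b) = trans (Bool.xor-identityʳ _) (N₀ b)
  N (suc a) zero = trans (cong (row K y (true , true) a xor_) (Bool.∧-zeroʳ _))
                     (trans (Bool.xor-identityʳ _) (trans (N₀ a) (symE (suc y) (exchange y (suc a)))))
  N (suc a) (suc b) with a ≟ b
  ... | yes refl = trans (i a)
    (sym (proj₂ (add-simple si (row H y pendant)) (exchange y (suc a))))
  ... | no a≢b = go (a ≟ y) (b ≟ y)
    where
    go : Dec (a ≡ y) → Dec (b ≡ y) →
         (H a b xor (H a y ∧ H b y)) xor (row K y (true , true) a ∧ row K y (true , true) b) ≡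
         extend H y pendant (exchange y (suc a)) (exchange y (suc b))
    go (yes refl) (yes refl) = ⊥-elim (a≢b refl)
    go (yes refl) (no b≢y)
      rewrite exchange-hit a | exchange-miss b≢y | fʸ | fᵒ b≢y | dec-false (b ≟ a) b≢y | i a
      = truthTable 1 (λ h → (h xor false) xor h) (λ h → false) (H a b)
    go (no a≢y) (yes refl)
      rewrite exchange-hit b | exchange-miss a≢y | fʸ | fᵒ a≢y | dec-false (a ≟ b) a≢y | i b | s b a
      = truthTable 1 (λ h → (h xor (h ∧ false)) xor (h ∧ true)) (λ h → false) (H a b)
    go (no a≢y) (no b≢y)
      rewrite exchange-miss a≢y | exchange-miss b≢y | fᵒ a≢y | fᵒ b≢y | s a y | s b y
      = truthTable 3 (λ h k l → (h xor k ∧ l) xor k ∧ l) (λ h k l → h) (H a b) (H y a) (H y b)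

pendant-pivot : ∀ {H : Adj n} → IsSimple H → ∀ y → Iso (pivot (extend H y pendant) zero (suc y)) (extend H y pendant)
pendant-pivot {H = H} si y =
  Iso-trans {B = lc² H y} {C = A}
            (≈⇒Iso (lc-cong (lc-cong (lc-leaf {A = A} zero (pendant-leaf H y)) (suc y)) zero))
            (exchangeₚ y , lc²-preserves si y)
  where A = extend H y pendant

pendant-pivot′ : ∀ {H : Adj n} → IsSimple H → ∀ y →
                 Preserves (exchangeₚ y) (pivot (extend H y pendant) (suc y) zero) (extend H y pendant)
pendant-pivot′ {H = H} si y a b =
  trans (lc-leaf {A = lc² H y} (suc y) leaf a b) (lc²-preserves si y a b)
  where
  col : ∀ a → lc² H y a (suc y) ≡ extend H y pendant (exchange y a) zero
  col a = trans (lc²-preserves si y a (suc y)) (cong (extend H y pendant (exchange y a)) (exchange-hit y))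
  leaf : ∀ a b → a ≢ b → lc² H y a (suc y) ∧ lc² H y b (suc y) ≡ false
  leaf a b a≢b rewrite col a | col b =
    pendant-leaf H y _ _ (a≢b ∘ perm-injective (exchangeₚ y))

-- Built graphs

-- The equation on `c` excludes true twins. As `grow` puts the new vertex at `zero`, `relabel` is
-- what allows it to be any vertex.
data Built : ∀ {n} → Adj n → Set where
  small   : ∀ {G : Adj n} → n ≤ 1 → IsSimple G → Built G
  grow    : ∀ {H : Adj n} → Built H → ∀ y c → proj₁ c ∧ proj₂ c ≡ false → Built (extend H y c)
  relabel : ∀ {G : Adj m} {H : Adj n} → Iso G H → Built H → Built G

built-simple : ∀ {G : Adj n} → Built G → IsSimple G
built-simple (small _ s)     = s
built-simple (grow b y c _)  = add-simple (built-simple b) _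
built-simple (relabel φ b)   = simple-relabel φ (built-simple b)

-- `grow` has to name some `y` even for an isolated vertex, hence the separate case of the empty
-- graph.
grow-isolated : ∀ {H : Adj n} → Built H → ∀ f → (∀ b → f b ≡ false) → Built (add H f)
grow-isolated {zero}  b f h = small (s≤s z≤n) (add-simple (built-simple b) f)
grow-isolated {suc n} b f h = relabel (≈⇒Iso (add-cong (λ _ _ → refl) h)) (grow b zero isolated refl)

attach : ∀ {G : Adj (suc n)} → IsSimple G → ∀ x → Built (delete G x) → ∀ y c → proj₁ c ∧ proj₂ c ≡ false →
         (∀ b → G x (punchIn x b) ≡ row (delete G x) y c b) → Built G
attach {G = G} si x b y c ok h =
  relabel {H = add (delete G x) (G x ∘ punchIn x)} (Iso-sym (bringToFront si x))
    (relabel {H = extend (delete G x) y c} (≈⇒Iso (add-cong (λ _ _ → refl) h)) (grow b y c ok))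

attach-isolated : ∀ {G : Adj (suc n)} → IsSimple G → ∀ x → Built (delete G x) →
                  (∀ b → G x (punchIn x b) ≡ false) → Built G
attach-isolated si x b h = relabel (Iso-sym (bringToFront si x)) (grow-isolated b _ h)

-- Closure of built graphs under pivots and deletions

pivoted-ok : ∀ (u v y : Fin n) c → proj₁ c ∧ proj₂ c ≡ false →
             proj₁ (pivoted u v y c) ∧ proj₂ (pivoted u v y c) ≡ false
pivoted-ok u v y (α , β) ok with onEdge u v y
... | true  = trans (Bool.∧-comm β α) ok
... | false = ok

grow-pivot : ∀ {H : Adj n} → IsSimple H → ∀ u v → H u v ≡ true → Built (pivot H u v) →
             ∀ y c → proj₁ c ∧ proj₂ c ≡ false → Built (pivot (extend H y c) (suc u) (suc v))
grow-pivot {H = H} si u v e b y c ok =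
  relabel {H = extend (pivot H u v) y (pivoted u v y c)} (≈⇒Iso (pivot-extend si u v e y c))
    (grow b y (pivoted u v y c) (pivoted-ok u v y c ok))

does-true : ∀ {P : Set} (d : Dec P) → does d ≡ true → P
does-true (yes p) _ = p

-- Induction on the construction. A pivot among old vertices only changes the coefficients of the
-- new one. At a pendant vertex the only edge goes to `y`, and pivoting it amounts to the exchange
-- of its ends. At a twin the pivot is moved to `y`.
built-pivot : ∀ {G : Adj n} → Built G → ∀ u v → G u v ≡ true → Built (pivot G u v)
built-pivot (small (s≤s z≤n) (_ , i)) zero zero e = ⊥-elim (true≢false (trans (sym e) (i zero)))
built-pivot (relabel {G = G} {H} (f , p) b) u v e =
  relabel (f , pivot-preserves f {G} {H} p u v) (built-pivot b _ _ (trans (sym (p u v)) e))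
built-pivot (grow b y c ok) (suc u) (suc v) e =
  grow-pivot (built-simple b) u v e (built-pivot b u v e) y c ok
built-pivot (grow {H = H} b y (true , false) ok) zero (suc z) e
  with refl ← does-true (z ≟ y) (trans (sym (Bool.xor-identityʳ _)) e)
  = relabel (pendant-pivot (built-simple b) y) (grow b y pendant ok)
built-pivot (grow {H = H} b y (true , false) ok) (suc z) zero e
  with refl ← does-true (z ≟ y) (trans (sym (Bool.xor-identityʳ _)) e)
  = relabel (exchangeₚ y , pendant-pivot′ (built-simple b) y) (grow b y pendant ok)
built-pivot (grow {H = H} b y (false , true) ok) zero (suc z) e =
  relabel {H = pivot (extend H y twin) (suc y) (suc z)}
    (exchangeₚ y , λ a b′ → trans (pivot-preserves (exchangeₚ y) {extend H y twin} {extend H y twin}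
            (twin-automorphism si y) zero (suc z) a b′)
            (cong (λ w → pivot (extend H y twin) (suc y) w (exchange y a) (exchange y b′))
                  (exchange-miss (≢-adjacent si e ∘ sym))))
    (grow-pivot si y z e (built-pivot b y z e) y twin refl)
  where si = built-simple b
built-pivot (grow {H = H} b y (false , true) ok) (suc z) zero e =
  relabel {H = pivot (extend H y twin) (suc z) (suc y)}
    (exchangeₚ y , λ a b′ → trans (pivot-preserves (exchangeₚ y) {extend H y twin} {extend H y twin}
            (twin-automorphism si y) (suc z) zero a b′)
            (cong (λ w → pivot (extend H y twin) w (suc y) (exchange y a) (exchange y b′))
                  (exchange-miss (≢-adjacent si e ∘ sym))))
    (grow-pivot si z y e′ (built-pivot b z y e′) y twin refl)
  where
  si = built-simple b
  e′ = trans (proj₁ si z y) e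

-- The case to watch is the deletion of `y` itself: a pendant vertex at `y` becomes isolated, and a
-- twin of `y` takes its place, which gives back `H`.
built-delete : ∀ {G : Adj (suc n)} → Built G → ∀ v → Built (delete G v)
built-delete (small (s≤s n≤0) s) v = small (ℕ.≤-trans n≤0 z≤n) (delete-simple s v)
built-delete {n} (relabel {n = suc k} {G = G} {H = H} φ b) v =
  relabel {H = delete H (proj₁ φ ⟨$⟩ʳ v)} (delete-Iso {G = G} {H = H} φ v) (built-delete b _)
built-delete (relabel {n = zero} (f , _) b) v with () ← f ⟨$⟩ʳ v
built-delete (grow b y c ok) zero = b
built-delete {suc n} (grow {H = H} b y c ok) (suc v) with v ≟ y
... | no v≢y = relabel {H = extend (delete H v) (punchOut v≢y) c} (≈⇒Iso (delete-extend H v (punchIn-punchOut v≢y) c))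
                       (grow (built-delete b v) (punchOut v≢y) c ok)
... | yes refl = relabel {H = add (delete H v) (row H v c ∘ punchIn v)} (≈⇒Iso (delete-add H (row H v c) v)) (go c ok)
  where
  go : ∀ c → proj₁ c ∧ proj₂ c ≡ false → Built (add (delete H v) (row H v c ∘ punchIn v))
  go (false , false) _ = grow-isolated (built-delete b v) _ λ _ → refl
  go (true , false)  _ = grow-isolated (built-delete b v) _ λ b →
    trans (Bool.xor-identityʳ _) (dec-false (punchIn v b ≟ v) (punchInᵢ≢i v b))
  go (false , true)  _ = relabel (bringToFront (built-simple b) v) b

built-pivotMinor : ∀ {G : Adj m} {H : Adj n} → PivotMinor G H → Built H → Built G
built-pivotMinor (pm-iso φ)       b = relabel φ b
built-pivotMinor (pm-del v p)     b = built-pivotMinor p (built-delete b v)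
built-pivotMinor (pm-piv u v e p) b = built-pivotMinor p (built-pivot b u v e)

-- Forests

AtMostOneNeighbour : Adj n → Fin n → Set
AtMostOneNeighbour A v = ∀ x y → A v x ≡ true → A v y ≡ true → x ≡ y

-- A path that can no longer be prolonged at its initial vertex p 0 shows that p 0 has at most one
-- neighbour: a second neighbour would lie on the path and close a cycle.
prolong : ∀ {N} {A : Adj N} → IsSimple A → ¬ HasCycle A → ∀ fuel k → k + fuel ≡ N → (p : ℕ → Fin N) →
          (∀ {i j} → i ≤ k → j ≤ k → p i ≡ p j → i ≡ j) → (∀ {i} → i < k → A (p i) (p (suc i)) ≡ true) →
          ∃ (AtMostOneNeighbour A)
prolong {N} si ac zero k e p inj adj =
  -- Out of fuel, `k` equals `N`, and the path would have `N + 1` distinct vertices.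
  ⊥-elim (ℕ.<-irrefl (trans (sym (ℕ.+-identityʳ k)) e) (injective⇒≤ {f = p ∘ toℕ} inj′))
  where
  inj′ : Injective _≡_ _≡_ (λ (i : Fin (suc k)) → p (toℕ i))
  inj′ {i} {j} q = toℕ-injective (inj (s≤s⁻¹ (toℕ<n i)) (s≤s⁻¹ (toℕ<n j)) q)
prolong {N} {A} si ac (suc fuel) k e p inj adj
  with any? (λ z → (A (p 0) z Bool.≟ true) ×-dec ¬? (ℕ.anyUpTo? (λ i → z ≟ p i) (suc k)))
... | yes (z , ez , fresh) = prolong si ac fuel (suc k) (trans (sym (ℕ.+-suc k fuel)) e) p′ inj′ adj′
  where
  p′ : ℕ → Fin N
  p′ zero    = z
  p′ (suc i) = p i
  inj′ : ∀ {i j} → i ≤ suc k → j ≤ suc k → p′ i ≡ p′ j → i ≡ j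
  inj′ {zero}  {zero}  _ _ _ = refl
  inj′ {zero}  {suc j} _ j≤ q = ⊥-elim (fresh (j , j≤ , q))
  inj′ {suc i} {zero}  i≤ _ q = ⊥-elim (fresh (i , i≤ , sym q))
  inj′ {suc i} {suc j} (s≤s i≤) (s≤s j≤) q = cong suc (inj i≤ j≤ q)
  adj′ : ∀ {i} → i < suc k → A (p′ i) (p′ (suc i)) ≡ true
  adj′ {zero}  _        = trans (proj₁ si z (p 0)) ez
  adj′ {suc i} (s≤s i<) = adj i<
... | no stuck = p 0 , λ x y ex ey → trans (second ex) (sym (second ey))
  where
  first : ∀ i → i ≤ k → A (p 0) (p i) ≡ true → i ≡ 1
  first zero          _  q = ⊥-elim (≢-adjacent si q refl)
  first (suc zero)    _  q = refl
  first (suc (suc m)) m≤ q = ⊥-elim (ac (m , (p ∘ toℕ) , inj′ , adj′ , close))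
    where
    bound : ∀ (i : Fin (suc (suc (suc m)))) → toℕ i ≤ k
    bound i = ℕ.≤-trans (s≤s⁻¹ (toℕ<n i)) m≤
    inj′ : Injective _≡_ _≡_ (λ (i : Fin (suc (suc (suc m)))) → p (toℕ i))
    inj′ {i} {j} r = toℕ-injective (inj (bound i) (bound j) r)
    adj′ : ∀ (i : Fin (suc (suc m))) → A (p (toℕ (inject₁ i))) (p (suc (toℕ i))) ≡ true
    adj′ i rewrite toℕ-inject₁ i = adj (ℕ.≤-trans (toℕ<n i) m≤)
    close : A (p (toℕ (fromℕ (suc (suc m))))) (p 0) ≡ true
    close rewrite toℕ-fromℕ m = trans (proj₁ si _ _) q
  second : ∀ {x} → A (p 0) x ≡ true → x ≡ p 1
  second {x} ex
    with i , i< , refl ← decidable-stable (ℕ.anyUpTo? (λ i → x ≟ p i) (suc k)) (λ off → stuck (x , ex , off))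
    = cong p (first i (s≤s⁻¹ i<) ex)

acyclic-leaf : ∀ {A : Adj (suc n)} → IsSimple A → ¬ HasCycle A → ∃ (AtMostOneNeighbour A)
acyclic-leaf {n} si ac = prolong si ac (suc n) 0 refl (λ _ → zero) (λ { z≤n z≤n _ → refl }) (λ ())

delete-acyclic : ∀ {A : Adj (suc n)} v → ¬ HasCycle A → ¬ HasCycle (delete A v)
delete-acyclic v ac (k , c , inj , adj , close) =
  ac (k , punchIn v ∘ c , inj ∘ punchIn-injective v _ _ , adj , close)

-- A vertex with at most one neighbour is deleted and comes back as an isolated or a pendant vertex.
acyclic-built : ∀ {A : Adj n} → IsSimple A → ¬ HasCycle A → Built A
acyclic-built {zero}  si ac = small z≤n si
acyclic-built {suc n} {A} si ac with acyclic-leaf si ac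
... | v , leaf with acyclic-built (delete-simple si v) (delete-acyclic {A = A} v ac)
                  | any? (λ w → A v (punchIn v w) Bool.≟ true)
...   | b | no none     = attach-isolated si v b λ w → Bool.¬-not (λ e → none (w , e))
...   | b | yes (w , e) = attach si v b w pendant refl nbr
  where
  nbr : ∀ z → A v (punchIn v z) ≡ does (z ≟ w) xor false
  nbr z with z ≟ w
  ... | yes refl = e
  ... | no z≢w   = Bool.¬-not (λ e′ → z≢w (punchIn-injective v z w (leaf _ _ e′ e)))

-- Walks and hanging a vertex on a tree

-- Edges may be contracted by `π`, as happens when leaves are folded into their neighbours.
walk-map : ∀ {A : Adj m} {B : Adj n} (π : Fin m → Fin n) →
           (∀ x z → A x z ≡ true → B (π x) (π z) ≡ true ⊎ π x ≡ π z) →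
           ∀ {x y} → Walk A x y → Walk B (π x) (π y)
walk-map π h here = here
walk-map {B = B} π h {x} {y} (step {z = z} e w) with h x z e
... | inj₁ e′ = step e′ (walk-map π h w)
... | inj₂ q  = subst (λ u → Walk B u (π y)) (sym q) (walk-map π h w)

walk-snoc : ∀ {A : Adj n} {x y z} → Walk A x y → A y z ≡ true → Walk A x z
walk-snoc here       e = step e here
walk-snoc (step d w) e = step d (walk-snoc w e)

removeEdge-keeps : ∀ (A : Adj n) u v {x y} → A x y ≡ true → ¬ (x ≡ u × y ≡ v) → ¬ (x ≡ v × y ≡ u) →
                   removeEdge A u v x y ≡ true
removeEdge-keeps A u v {x} {y} e h k with x ≟ u | y ≟ v | x ≟ v | y ≟ u
... | yes p | yes q | _     | _     = ⊥-elim (h (p , q))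
... | _     | _     | yes p | yes q = ⊥-elim (k (p , q))
... | yes _ | no _  | yes _ | no _  = e
... | yes _ | no _  | no _  | _     = e
... | no _  | _     | yes _ | no _  = e
... | no _  | _     | no _  | _     = e

removeEdge-⊆ : ∀ (A : Adj n) u v x y → removeEdge A u v x y ≡ true → A x y ≡ true
removeEdge-⊆ A u v x y e with does (x ≟ u) ∧ does (y ≟ v) | does (x ≟ v) ∧ does (y ≟ u)
... | false | false = e

removeEdge-removed : ∀ (A : Adj n) u v → removeEdge A u v u v ≢ true
removeEdge-removed A u v e rewrite dec-true (u ≟ u) refl | dec-true (v ≟ v) refl with () ← e

pendant-row : ∀ (T : Adj n) l b → row T l pendant b ≡ true → b ≡ l
pendant-row T l b e = does-true (b ≟ l) (trans (sym (Bool.xor-identityʳ _)) e)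

pendant-row-self : ∀ (T : Adj n) l → row T l pendant l ≡ true
pendant-row-self T l rewrite dec-true (l ≟ l) refl = refl

pendant-row-other : ∀ (T : Adj n) {l b} → b ≢ l → row T l pendant b ≡ false
pendant-row-other T {l} {b} b≢l rewrite dec-false (b ≟ l) b≢l = refl

-- These are the two neighbours along the cycle. The last and the first position are treated apart
-- because the closing edge is used there.
cycle-neighbours : ∀ {A : Adj n} → IsSimple A → ((k , c , _) : HasCycle A) → ∀ i →
                   Σ (Fin (suc (suc (suc k)))) λ j → Σ (Fin (suc (suc (suc k)))) λ j′ →
                   j ≢ j′ × A (c i) (c j) ≡ true × A (c i) (c j′) ≡ true
cycle-neighbours (s , _) (k , c , inj , adj , close) i with view i
... | ‵fromℕ         = zero , inject₁ (fromℕ (suc k)) , (λ ()) , close , trans (s _ _) (adj (fromℕ (suc k)))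
... | ‵inject₁ zero    = suc zero , fromℕ (suc (suc k)) , (λ ()) , adj zero , trans (s _ _) close
... | ‵inject₁ (suc j) =
  suc (suc j) , inject₁ (inject₁ j) , distinct , adj (suc j) , trans (s _ _) (adj (inject₁ j))
  where
  distinct : suc (suc j) ≢ inject₁ (inject₁ j)
  distinct q = ℕ.m≢1+n+m (toℕ j)
    (trans (sym (trans (toℕ-inject₁ (inject₁ j)) (toℕ-inject₁ j))) (cong toℕ (sym q)))

-- A cycle through the hung vertex would give it two neighbours, and a cycle that avoids it lies in
-- `T`.
hang-acyclic : ∀ {T : Adj n} → IsSimple T → ¬ HasCycle T → ∀ l → ¬ HasCycle (extend T l pendant)
hang-acyclic {T = T} si ac l cyc@(k , c , inj , adj , close) with any? (λ i → zero ≟ c i)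
... | yes (i , ci) with j , j′ , j≢j′ , e , e′ ← cycle-neighbours (add-simple si _) cyc i =
  j≢j′ (inj (trans (only (c j) (via e)) (sym (only (c j′) (via e′)))))
  where
  via : ∀ {b} → extend T l pendant (c i) b ≡ true → extend T l pendant zero b ≡ true
  via {b} = subst (λ a → extend T l pendant a b ≡ true) (sym ci)
  only : ∀ b → extend T l pendant zero b ≡ true → b ≡ suc l
  only (suc b) q = cong suc (pendant-row T l b q)
... | no avoids = ac (k , c′ , inj′ , (λ i → below (adj i)) , below close)
  where
  c′ : ∀ i → Fin _
  c′ i = punchOut {i = zero} {j = c i} (λ q → avoids (i , q))
  lift : ∀ i → suc (c′ i) ≡ c i
  lift i = punchIn-punchOut {i = zero} (λ q → avoids (i , q))
  inj′ : Injective _≡_ _≡_ c′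
  inj′ {i} {j} q = inj (trans (sym (lift i)) (trans (cong suc q) (lift j)))
  below : ∀ {i j} → extend T l pendant (c i) (c j) ≡ true → T (c′ i) (c′ j) ≡ true
  below {i} {j} = subst₂ (λ a b → extend T l pendant a b ≡ true) (sym (lift i)) (sym (lift j))

hang-connected : ∀ {T : Adj n} → IsSimple T → Connected T → ∀ l → Connected (extend T l pendant)
hang-connected {T = T} si con l = go
  where
  lift : ∀ a b → Walk (extend T l pendant) (suc a) (suc b)
  lift a b = walk-map suc (λ _ _ → inj₁) (con a b)
  up = pendant-row-self T l
  go : Connected (extend T l pendant)
  go zero    zero    = here
  go zero    (suc b) = step up (lift l b)
  go (suc a) zero    = walk-snoc (lift a l) up
  go (suc a) (suc b) = lift a b

hang-tree : ∀ {T : Adj n} → IsTree T → ∀ l → IsTree (extend T l pendant)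
hang-tree (si , con , ac) l = add-simple si _ , hang-connected si con l , hang-acyclic si ac l

point : Adj 1
point _ _ = false

point-tree : IsTree point
point-tree = ((λ _ _ → refl) , λ _ → refl) , (λ { zero zero → here }) , λ { (_ , _ , _ , _ , ()) }

count-false : ∀ k → count {k} (λ _ → false) ≡ 0
count-false zero    = refl
count-false (suc k) = count-false k

degree-hung : ∀ (T : Adj n) l → degree (extend T l pendant) zero ≡ 1
degree-hung T l = go l
  where
  go : ∀ {k} (l : Fin k) → count (λ b → does (b ≟ l) xor false) ≡ 1
  go {suc k} zero    = cong suc (count-false k)
  go         (suc l) = go l

-- Cuts of rank at most one

-- The cut-rank condition for `k = 1` with its two rows and two coefficients spelled out; `c ∨ d`
-- says that the relation is nontrivial.
Rank1 : Adj n → (Fin n → Set) → Set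
Rank1 {n} A X = ∀ {a b} → a ≢ b → X a → X b → Σ Bool λ c → Σ Bool λ d →
  c ∨ d ≡ true × (∀ y → ¬ X y → (c ∧ A a y) xor (d ∧ A b y) ≡ false)

pair : ∀ {A : Set} → A → A → Fin 2 → A
pair a b zero    = a
pair a b (suc _) = b

pair-injective : ∀ {a b : Fin n} → a ≢ b → Injective _≡_ _≡_ (pair a b)
pair-injective a≢b {zero}     {zero}     _ = refl
pair-injective a≢b {zero}     {suc _}    q = ⊥-elim (a≢b q)
pair-injective a≢b {suc _}    {zero}     q = ⊥-elim (a≢b (sym q))
pair-injective a≢b {suc zero} {suc zero} _ = refl

cutRank⇒Rank1 : ∀ {A : Adj n} {X} → CutRankAtMost A 1 X → Rank1 A X
cutRank⇒Rank1 {n} {A} {X} h {a} {b} a≢b xa xb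
  with c , (i , ci) , dep ← h (pair a b) (pair-injective a≢b) (λ { zero → xa ; (suc _) → xb })
  = c zero , c (suc zero) , nonzero c i ci , λ y ¬xy →
      trans (cong ((c zero ∧ A a y) xor_) (sym (Bool.xor-identityʳ _))) (dep y ¬xy)
  where
  nonzero : ∀ (c : Fin 2 → Bool) i → c i ≡ true → c zero ∨ c (suc zero) ≡ true
  nonzero c zero       q rewrite q = refl
  nonzero c (suc zero) q rewrite q = Bool.∨-zeroʳ _

Rank1⇒cutRank : ∀ {A : Adj n} {X} → Rank1 A X → CutRankAtMost A 1 X
Rank1⇒cutRank {A = A} h r inj xr
  with c , d , nz , dep ← h {r zero} {r (suc zero)} (λ q → case inj q of λ ()) (xr zero) (xr (suc zero))
  = pair c d , index c d nz , λ y ¬xy →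
      trans (cong ((c ∧ A (r zero) y) xor_) (Bool.xor-identityʳ _)) (dep y ¬xy)
  where
  index : ∀ c d → c ∨ d ≡ true → Σ (Fin 2) λ i → pair c d i ≡ true
  index true  d    _ = zero , refl
  index false true _ = suc zero , refl

Rank1-singleton : ∀ {A : Adj n} {X : Fin n → Set} y → (∀ z → X z → z ≡ y) → Rank1 A X
Rank1-singleton y h a≢b xa xb = ⊥-elim (a≢b (trans (h _ xa) (sym (h _ xb))))

-- Only the column of `y` can lie outside `X`, and any two scalars are linearly dependent.
Rank1-cosingleton : ∀ {A : Adj n} {X : Fin n → Set} y → (∀ z → z ≢ y → X z) → Rank1 A X
Rank1-cosingleton {A = A} {X} y h {a} {b} a≢b xa xb = go (A a y) (A b y) refl refl
  where
  only : ∀ {f : Fin _ → Bool} → f y ≡ false → ∀ z → ¬ X z → f z ≡ false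
  only fy z ¬xz with z ≟ y
  ... | yes refl = fy
  ... | no z≢y   = ⊥-elim (¬xz (h z z≢y))
  go : ∀ p q → A a y ≡ p → A b y ≡ q → Σ Bool λ c → Σ Bool λ d →
       c ∨ d ≡ true × (∀ y → ¬ X y → (c ∧ A a y) xor (d ∧ A b y) ≡ false)
  go false q     e f = true , false , refl , only (trans (Bool.xor-identityʳ _) e)
  go true  false e f = false , true , refl , only f
  go true  true  e f = true , true , refl , only (cong₂ _xor_ e f)

collapse : Fin n → Fin (suc n) → Fin n
collapse y zero    = y
collapse y (suc z) = z

Rank1-extend : ∀ {H : Adj n} → IsSimple H → ∀ y c {X : Fin n → Set} {X⁺ : Fin (suc n) → Set} →
               (∀ z → X⁺ z → X (collapse y z)) → (∀ z → X (collapse y z) → X⁺ z) →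
               Rank1 H X → Rank1 (extend H y c) X⁺
Rank1-extend {n} {H} si y c@(α , β) {X} {X⁺} down up rk {a} {b} a≢b xa xb = go (ε a) (ε b) refl refl
  where
  E = extend H y c
  p = collapse y
  ε : Fin (suc n) → Bool
  ε zero    = β
  ε (suc _) = true
  -- The new vertex and y are on the same side, so δ_y does not contribute to the cut matrix: the
  -- new row or column is that of y scaled by β.
  entry : ∀ a z → X⁺ a → ¬ X⁺ z → E a z ≡ ε z ∧ (ε a ∧ H (p a) (p z))
  entry zero    zero    xa ¬xz = ⊥-elim (¬xz xa)
  entry zero    (suc z) xa ¬xz with z ≟ y
  ... | yes refl = ⊥-elim (¬xz (up (suc z) (down zero xa)))
  ... | no _     rewrite Bool.∧-zeroʳ α = refl
  entry (suc a) zero    xa ¬xz with a ≟ y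
  ... | yes refl = ⊥-elim (¬xz (up zero (down (suc a) xa)))
  ... | no _     rewrite Bool.∧-zeroʳ α | proj₁ si y a = refl
  entry (suc a) (suc z) xa ¬xz = refl
  go : ∀ s t → ε a ≡ s → ε b ≡ t → Σ Bool λ c → Σ Bool λ d →
       c ∨ d ≡ true × (∀ y → ¬ X⁺ y → (c ∧ E a y) xor (d ∧ E b y) ≡ false)
  go false t e f = true , false , refl , λ z ¬xz → zero-row z ¬xz
    where
    zero-row : ∀ z → ¬ X⁺ z → E a z xor false ≡ false
    zero-row z ¬xz rewrite entry a z xa ¬xz | e | Bool.∧-zeroʳ (ε z) = refl
  go true false e f = false , true , refl , zero-row
    where
    zero-row : ∀ z → ¬ X⁺ z → E b z ≡ false
    zero-row z ¬xz rewrite entry b z xb ¬xz | f = Bool.∧-zeroʳ (ε z)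
  -- Vertices that collapse to the same one have equal rows; otherwise the relation between the rows
  -- in `H` carries over.
  go true true e f with p a ≟ p b
  ... | yes q = true , true , refl , same
    where
    same : ∀ z → ¬ X⁺ z → E a z xor E b z ≡ false
    same z ¬xz rewrite entry a z xa ¬xz | entry b z xb ¬xz | e | f | q =
      Bool.xor-same (ε z ∧ H (p b) (p z))
  ... | no q with rk q (down a xa) (down b xb)
  ...   | s , t , nz , dep = s , t , nz , dep′
    where
    dep′ : ∀ z → ¬ X⁺ z → (s ∧ E a z) xor (t ∧ E b z) ≡ false
    dep′ z ¬xz rewrite entry a z xa ¬xz | entry b z xb ¬xz | e | f =
      trans (truthTable 5 (λ s t ε h k → (s ∧ (ε ∧ h)) xor (t ∧ (ε ∧ k))) (λ s t ε h k → ε ∧ ((s ∧ h) xor (t ∧ k)))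
               s t (ε z) (H (p a) (p z)) (H (p b) (p z)))
            (trans (cong (ε z ∧_) (dep (p z) (λ x → ¬xz (up z x)))) (Bool.∧-zeroʳ (ε z)))

-- From built graphs to rank decompositions

-- Both new nodes `zero` and `suc zero` hang at `l`; a leaf `l` thus becomes a node of degree 3.
twoLeaves : Adj n → Fin n → Adj (suc (suc n))
twoLeaves T l = extend (extend T l pendant) (suc l) pendant

module SplitLeaf {n} {H : Adj n} (simpleH : IsSimple H) (D : RankDecomposition n) (w : WidthAtMost H D 1)
                 (y : Fin n) (c : Bool × Bool) where
  open RankDecomposition D

  private
    l  = L y
    T⁺ = twoLeaves T l
    2+ : Fin t → Fin (suc (suc t))
    2+ v = suc (suc v)

  tree : IsTree T
  tree = proj₁ (proj₂ subcubic)

  tree⁺ : IsTree T⁺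
  tree⁺ = hang-tree (hang-tree tree l) (suc l)

  L⁺ : Fin (suc n) → Fin (suc (suc t))
  L⁺ zero    = zero
  L⁺ (suc z) = if does (z ≟ y) then suc zero else 2+ (L z)

  L⁺-injective : Injective _≡_ _≡_ L⁺
  L⁺-injective {zero}  {zero}  _ = refl
  L⁺-injective {zero}  {suc b} q with b ≟ y
  L⁺-injective {zero}  {suc b} () | yes _
  L⁺-injective {zero}  {suc b} () | no _
  L⁺-injective {suc a} {zero}  q with a ≟ y
  L⁺-injective {suc a} {zero}  () | yes _
  L⁺-injective {suc a} {zero}  () | no _
  L⁺-injective {suc a} {suc b} q with a ≟ y | b ≟ y
  ... | yes refl | yes refl = refl
  ... | no _     | no _     = cong suc (L-inj (suc-injective (suc-injective q)))
  L⁺-injective {suc a} {suc b} () | yes _ | no _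
  L⁺-injective {suc a} {suc b} () | no _ | yes _

  degree-zero : IsLeaf T⁺ zero
  degree-zero = degree-hung (extend T l pendant) (suc l)

  degree-one : IsLeaf T⁺ (suc zero)
  degree-one = degree-hung T l

  degree-split : degree T⁺ (2+ l) ≡ 3
  degree-split rewrite pendant-row-self T l = cong (λ d → suc (suc d)) (L-leaf y)

  degree-old : ∀ {v} → v ≢ l → degree T⁺ (2+ v) ≡ degree T v
  degree-old v≢l rewrite pendant-row-other T v≢l = refl

  L⁺-leaf : ∀ x → IsLeaf T⁺ (L⁺ x)
  L⁺-leaf zero = degree-zero
  L⁺-leaf (suc z) with z ≟ y
  ... | yes _   = degree-one
  ... | no z≢y = trans (degree-old (z≢y ∘ L-inj)) (L-leaf z)

  L⁺-onto : ∀ v → IsLeaf T⁺ v → Σ (Fin (suc n)) λ x → L⁺ x ≡ v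
  L⁺-onto zero       _ = zero , refl
  L⁺-onto (suc zero) _ = suc y , hit
    where
    hit : L⁺ (suc y) ≡ suc zero
    hit rewrite dec-true (y ≟ y) refl = refl
  L⁺-onto (suc (suc v)) leaf = go (v ≟ l)
    where
    miss : ∀ x → L x ≢ l → L⁺ (suc x) ≡ 2+ (L x)
    miss x h rewrite dec-false (x ≟ y) (h ∘ cong L) = refl
    go : Dec (v ≡ l) → Σ (Fin (suc n)) λ x → L⁺ x ≡ 2+ v
    go (yes refl) = case trans (sym degree-split) leaf of λ ()
    go (no v≢l) with L-onto v (trans (sym (degree-old v≢l)) leaf)
    ... | x , refl = suc x , miss x v≢l

  subcubic⁺ : IsSubcubicTree T⁺
  subcubic⁺ = s≤s (s≤s z≤n) , tree⁺ , λ
    { zero          h → ⊥-elim (h degree-zero)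
    ; (suc zero)    h → ⊥-elim (h degree-one)
    ; (suc (suc v)) h → cubic v h (v ≟ l) }
    where
    cubic : ∀ v → ¬ IsLeaf T⁺ (2+ v) → Dec (v ≡ l) → degree T⁺ (2+ v) ≡ 3
    cubic v h (yes refl) = degree-split
    cubic v h (no v≢l)   = trans (degree-old v≢l)
                      (proj₂ (proj₂ subcubic) v (λ q → h (trans (degree-old v≢l) q)))

  D⁺ : RankDecomposition (suc n)
  D⁺ = record
    { T = T⁺ ; subcubic = subcubic⁺ ; L = L⁺ ; L-inj = λ {a} {b} → L⁺-injective {a} {b}
    ; L-leaf = L⁺-leaf ; L-onto = L⁺-onto }

  -- Contracts the two new edges. It brings walks of `T⁺` down to `T`, and `lift-walk` goes back, so
  -- that an old edge separates the label of `z` just as it separated that of `collapse y z`.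
  fold : Fin (suc (suc t)) → Fin t
  fold zero          = l
  fold (suc zero)    = l
  fold (suc (suc v)) = v

  fold-L⁺ : ∀ z → fold (L⁺ z) ≡ L (collapse y z)
  fold-L⁺ zero = refl
  fold-L⁺ (suc z) with z ≟ y
  ... | yes refl = refl
  ... | no _     = refl

  zero-nbr : ∀ v → T⁺ zero v ≡ true → v ≡ 2+ l
  zero-nbr (suc v) e = cong suc (pendant-row (extend T l pendant) (suc l) v e)

  one-nbr : ∀ v → T⁺ (suc zero) v ≡ true → v ≡ 2+ l
  one-nbr (suc (suc v)) e = cong 2+ (pendant-row T l v e)

  zero-edge : T⁺ (2+ l) zero ≡ true
  zero-edge = pendant-row-self (extend T l pendant) (suc l)

  one-edge : T⁺ (2+ l) (suc zero) ≡ true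
  one-edge = pendant-row-self T l

  symmetric⁺ : ∀ a b → T⁺ a b ≡ T⁺ b a
  symmetric⁺ = proj₁ (proj₁ tree⁺)

  leaf-side : ∀ p → (∀ v → T⁺ p v ≡ true → v ≡ 2+ l) → ∀ {z} → Walk (removeEdge T⁺ p (2+ l)) p z → z ≡ p
  leaf-side p nbr here = refl
  leaf-side p nbr (step {z = v} e _) with nbr v (removeEdge-⊆ T⁺ p (2+ l) p v e)
  ... | refl = ⊥-elim (removeEdge-removed T⁺ p (2+ l) e)

  -- For the new vertex and for `y` the lifted walk ends at the old leaf and needs one more edge, to
  -- a new leaf; the second hypothesis provides that edge in `C`.
  lift-walk : ∀ {B : Adj t} {C : Adj (suc (suc t))} → (∀ {a b} → B a b ≡ true → C (2+ a) (2+ b) ≡ true) → ∀ z →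
              (∀ p → L⁺ z ≡ p → (∀ b → p ≢ 2+ b) → T⁺ (2+ l) p ≡ true → C (2+ l) p ≡ true) →
              ∀ {s} → Walk B s (L (collapse y z)) → Walk C (2+ s) (L⁺ z)
  lift-walk old zero new walk =
    walk-snoc (walk-map 2+ (λ _ _ e → inj₁ (old e)) walk) (new zero refl (λ _ ()) zero-edge)
  lift-walk old (suc z) new walk with z ≟ y
  ... | yes refl = walk-snoc (walk-map 2+ (λ _ _ e → inj₁ (old e)) walk) (new (suc zero) refl (λ _ ()) one-edge)
  ... | no _     = walk-map 2+ (λ _ _ e → inj₁ (old e)) walk

  stem-side : ∀ p → (∀ b → p ≢ 2+ b) → ∀ z → L⁺ z ≢ p → Walk (removeEdge T⁺ (2+ l) p) (2+ l) (L⁺ z)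
  stem-side p fresh z z≢ = lift-walk
    (λ {a} {b} e → removeEdge-keeps T⁺ (2+ l) p e (λ (_ , q) → fresh b (sym q)) (λ (q , _) → fresh a (sym q)))
    z (λ q r _ e → removeEdge-keeps T⁺ (2+ l) p e (λ (_ , s) → z≢ (trans r s)) (λ (s , _) → fresh l (sym s)))
    (proj₁ (proj₂ tree) l (L (collapse y z)))

  -- A new edge separates one label from all others. Both sides are treated because width is
  -- required for each orientation of an edge.
  hung-width : ∀ p x → L⁺ x ≡ p → (∀ b → p ≢ 2+ b) → (∀ v → T⁺ p v ≡ true → v ≡ 2+ l) →
               Rank1 (extend H y c) (λ z → Walk (removeEdge T⁺ p (2+ l)) p (L⁺ z)) ×
               Rank1 (extend H y c) (λ z → Walk (removeEdge T⁺ (2+ l) p) (2+ l) (L⁺ z))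
  hung-width p x refl fresh nbr =
    Rank1-singleton x (λ z walk → L⁺-injective (leaf-side p nbr walk)) ,
    Rank1-cosingleton x (λ z z≢x → stem-side p fresh z (z≢x ∘ L⁺-injective))

  zero-width = hung-width zero zero refl (λ _ ()) zero-nbr
  one-width  = hung-width (suc zero) (suc y) (proj₂ (L⁺-onto (suc zero) degree-one)) (λ _ ()) one-nbr

  width⁺ : WidthAtMost (extend H y c) D⁺ 1
  width⁺ zero v e with refl ← zero-nbr v e = Rank1⇒cutRank (proj₁ zero-width)
  width⁺ (suc zero) v e with refl ← one-nbr v e = Rank1⇒cutRank (proj₁ one-width)
  width⁺ u@(suc (suc _)) zero e with refl ← zero-nbr u (trans (symmetric⁺ zero u) e) =
    Rank1⇒cutRank (proj₂ zero-width)
  width⁺ u@(suc (suc _)) (suc zero) e with refl ← one-nbr u (trans (symmetric⁺ (suc zero) u) e) =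
    Rank1⇒cutRank (proj₂ one-width)
  width⁺ (suc (suc a)) (suc (suc b)) e =
    Rank1⇒cutRank (Rank1-extend simpleH y c down up (cutRank⇒Rank1 (w a b e)))
    where
    edge : ∀ u v → removeEdge T⁺ (2+ a) (2+ b) u v ≡ true →
           removeEdge T a b (fold u) (fold v) ≡ true ⊎ fold u ≡ fold v
    edge zero v e with refl ← zero-nbr v (removeEdge-⊆ T⁺ (2+ a) (2+ b) zero v e) = inj₂ refl
    edge (suc zero) v e with refl ← one-nbr v (removeEdge-⊆ T⁺ (2+ a) (2+ b) (suc zero) v e) = inj₂ refl
    edge u@(suc (suc _)) zero e
      with refl ← zero-nbr u (trans (symmetric⁺ zero u) (removeEdge-⊆ T⁺ (2+ a) (2+ b) u zero e)) = inj₂ refl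
    edge u@(suc (suc _)) (suc zero) e
      with refl ← one-nbr u (trans (symmetric⁺ (suc zero) u) (removeEdge-⊆ T⁺ (2+ a) (2+ b) u (suc zero) e)) = inj₂ refl
    edge (suc (suc u)) (suc (suc v)) e = inj₁ e
    down : ∀ z → Walk (removeEdge T⁺ (2+ a) (2+ b)) (2+ a) (L⁺ z) → Walk (removeEdge T a b) a (L (collapse y z))
    down z walk = subst (Walk _ a) (fold-L⁺ z) (walk-map fold edge walk)
    up : ∀ z → Walk (removeEdge T a b) a (L (collapse y z)) → Walk (removeEdge T⁺ (2+ a) (2+ b)) (2+ a) (L⁺ z)
    up z = lift-walk id z λ p _ fresh e →
      removeEdge-keeps T⁺ (2+ a) (2+ b) {2+ l} e (λ (_ , q) → fresh b q) (λ (_ , q) → fresh a q)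

-- A single vertex comes without a decomposition to extend, so the one for two vertices is given
-- outright.
oneEdge : RankDecomposition 2
oneEdge = record
  { T = extend point zero pendant
  ; subcubic = s≤s (s≤s z≤n) , hang-tree point-tree zero ,
               λ { zero h → ⊥-elim (h refl) ; (suc zero) h → ⊥-elim (h refl) }
  ; L = id
  ; L-inj = id
  ; L-leaf = λ { zero → refl ; (suc zero) → refl }
  ; L-onto = λ v _ → v , refl }

-- Two distinct members of `X` are all the vertices, so no column remains.
Rank1-two : ∀ {A : Adj 2} {X} → Rank1 A X
Rank1-two {A} {X} {a} {b} a≢b xa xb = true , true , refl , λ y ¬xy → ⊥-elim (¬xy (all a b y a≢b xa xb))
  where
  all : ∀ a b y → a ≢ b → X a → X b → X y
  all zero       zero       _          a≢b _  _  = ⊥-elim (a≢b refl)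
  all (suc zero) (suc zero) _          a≢b _  _  = ⊥-elim (a≢b refl)
  all zero       (suc zero) zero       _   xa _  = xa
  all zero       (suc zero) (suc zero) _   _  xb = xb
  all (suc zero) zero       zero       _   _  xb = xb
  all (suc zero) zero       (suc zero) _   xa _  = xa

relabel-rankWidth : ∀ {G : Adj m} {H : Adj n} → Iso G H → RankWidthAtMost H 1 → RankWidthAtMost G 1
relabel-rankWidth (f , _) (inj₁ n≤1) = inj₁ (ℕ.≤-trans (ℕ.≤-reflexive (Perm.↔⇒≡ f)) n≤1)
relabel-rankWidth {G = G} {H} (f , p) (inj₂ (D , w)) = inj₂ (record
  { T = T ; subcubic = subcubic
  ; L = L ∘ (f ⟨$⟩ʳ_)
  ; L-inj = perm-injective f ∘ L-inj
  ; L-leaf = λ x → L-leaf _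
  ; L-onto = λ v h → let x , e = L-onto v h in f ⟨$⟩ˡ x , trans (cong L (inverseʳ f)) e } ,
  λ u v e → Rank1⇒cutRank (pull (cutRank⇒Rank1 (w u v e))))
  where
  open RankDecomposition D
  pull : ∀ {X} → Rank1 H X → Rank1 G (X ∘ (f ⟨$⟩ʳ_))
  pull h {a} {b} a≢b xa xb with h (a≢b ∘ perm-injective f) xa xb
  ... | c , d , nz , dep = c , d , nz , λ y ¬xy →
    trans (cong₂ (λ s t → (c ∧ s) xor (d ∧ t)) (p a y) (p b y)) (dep _ ¬xy)

built-rankWidth : ∀ {G : Adj n} → Built G → RankWidthAtMost G 1
built-rankWidth (small n≤1 _)  = inj₁ n≤1
built-rankWidth (relabel {G = G} {H} φ b)  = relabel-rankWidth {G = G} {H} φ (built-rankWidth b)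
built-rankWidth (grow {H = H} b y c _) with built-rankWidth b
... | inj₁ (s≤s z≤n) = inj₂ (oneEdge , λ _ _ _ → Rank1⇒cutRank (Rank1-two {A = extend H y c}))
... | inj₂ (D , w)   = inj₂ (D⁺ , width⁺)
  where open SplitLeaf (built-simple b) D w y c

built-bipartite : ∀ {G : Adj n} → Built G → Bipartite G
built-bipartite (small {G = G} (s≤s z≤n) (_ , i)) =
  (λ _ → true) , λ { zero zero e → ⊥-elim (true≢false (trans (sym e) (i zero))) }
built-bipartite (small z≤n _) = (λ ()) , λ ()
built-bipartite (relabel (f , p) b) with col , proper ← built-bipartite b =
  col ∘ (f ⟨$⟩ʳ_) , λ x y e → proper _ _ (trans (sym (p x y)) e)
built-bipartite (grow {n = n} {H = H} b y c@(α , β) ok) = col⁺ , λ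
  { zero (suc z) e → new c ok z e
  ; (suc z) zero e → new c ok z e ∘ sym
  ; (suc x) (suc z) e → proper x z e }
  where
  col    = proj₁ (built-bipartite b)
  proper = proj₂ (built-bipartite b)
  col⁺ : Fin (suc n) → Bool
  -- A pendant vertex gets the colour opposite to that of `y`, a twin or an isolated vertex the same
  -- colour.
  col⁺ zero    = α xor col y
  col⁺ (suc z) = col z
  new : ∀ c → proj₁ c ∧ proj₂ c ≡ false → ∀ z → row H y c z ≡ true → proj₁ c xor col y ≢ col z
  new (true , false) _ z e q with refl ← pendant-row H y z e = Bool.not-¬ refl (sym q)
  new (false , true) _ z e q = proper y z e q

-- From rank decompositions to built graphs

count-punchIn : ∀ {k} (f : Fin (suc k) → Bool) v → count f ≡ (if f v then 1 else 0) + count (f ∘ punchIn v)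
count-punchIn         f zero    = refl
count-punchIn {suc k} f (suc v) = trans (cong ((if f zero then 1 else 0) +_) (count-punchIn (f ∘ suc) v))
  (trans (sym (ℕ.+-assoc (if f zero then 1 else 0) (if f (suc v) then 1 else 0) _))
  (trans (cong (_+ count (f ∘ suc ∘ punchIn v)) (ℕ.+-comm (if f zero then 1 else 0) (if f (suc v) then 1 else 0)))
         (ℕ.+-assoc (if f (suc v) then 1 else 0) (if f zero then 1 else 0) _)))

count-hit : ∀ {k} (f : Fin (suc k) → Bool) v → f v ≡ true → count f ≡ suc (count (f ∘ punchIn v))
count-hit f v e = trans (count-punchIn f v) (cong (λ b → (if b then 1 else 0) + count (f ∘ punchIn v)) e)

count-two : ∀ {k} (f : Fin k → Bool) {a b} → a ≢ b → f a ≡ true → f b ≡ true → 2 ≤ count f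
count-two {suc zero}    f {zero} {zero} a≢b _ _ = ⊥-elim (a≢b refl)
count-two {suc (suc k)} f {a} {b} a≢b ea eb = ℕ.≤-trans (s≤s one) (ℕ.≤-reflexive (sym (count-hit f a ea)))
  where
  one : 1 ≤ count (f ∘ punchIn a)
  one = ℕ.≤-trans (s≤s z≤n) (ℕ.≤-reflexive (sym
    (count-hit (f ∘ punchIn a) (punchOut a≢b) (trans (cong f (punchIn-punchOut a≢b)) eb))))

degree-delete : ∀ (T : Adj (suc n)) v u → degree (delete T v) u ≤ degree T (punchIn v u)
degree-delete T v u = ℕ.≤-trans (ℕ.m≤n+m _ _) (ℕ.≤-reflexive (sym (count-punchIn (T (punchIn v u)) v)))

walk-closed : ∀ {A : Adj n} (P : Fin n → Set) → (∀ {a b} → P a → A a b ≡ true → P b) →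
              ∀ {a b} → P a → Walk A a b → P b
walk-closed P h p here       = p
walk-closed P h p (step e w) = walk-closed P h (h p e) w

attach-at-most-pendant : ∀ {G : Adj (suc n)} → IsSimple G → ∀ {x y} → x ≢ y → (∀ z → z ≢ x → z ≢ y → G x z ≡ false) →
                         Built (delete G x) → Built G
attach-at-most-pendant {G = G} si {x} {y} x≢y h b with G x y in e
... | false = attach-isolated si x b row0
  where
  row0 : ∀ z → G x (punchIn x z) ≡ false
  row0 z with punchIn x z ≟ y
  ... | yes q = trans (cong (G x) q) e
  ... | no q  = h _ (punchInᵢ≢i x z) q
... | true = attach si x b (punchOut x≢y) pendant refl rowδ
  where
  rowδ : ∀ z → G x (punchIn x z) ≡ does (z ≟ punchOut x≢y) xor false
  rowδ z with z ≟ punchOut x≢y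
  ... | yes refl = trans (cong (G x) (punchIn-punchOut x≢y)) e
  ... | no q = h _ (punchInᵢ≢i x z) λ r → q (punchIn-injective x _ _ (trans r (sym (punchIn-punchOut x≢y))))

-- If `x` and `y` are adjacent, two colours leave no room for a common neighbour and `x` is pendant
-- at `y`. Otherwise it is a false twin.
attach-twin : ∀ {G : Adj (suc n)} → IsSimple G → Bipartite G → ∀ {x y} → x ≢ y →
              (∀ z → z ≢ x → z ≢ y → G x z ≡ G y z) → Built (delete G x) → Built G
attach-twin {G = G} si@(s , i) (col , proper) {x} {y} x≢y h b with G x y in e
... | true = attach-at-most-pendant si x≢y no-common b
  where
  two-colours : ∀ {p q r : Bool} → p ≢ q → p ≢ r → q ≢ r → ⊥
  two-colours p≢q p≢r q≢r = q≢r (trans (Bool.¬-not (p≢q ∘ sym)) (sym (Bool.¬-not (p≢r ∘ sym))))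
  no-common : ∀ z → z ≢ x → z ≢ y → G x z ≡ false
  no-common z z≢x z≢y = Bool.¬-not λ f →
    two-colours (proper x y e) (proper x z f) (proper y z (trans (sym (h z z≢x z≢y)) f))
... | false = attach si x b (punchOut x≢y) twin refl same
  where
  same : ∀ z → G x (punchIn x z) ≡ G (punchIn x (punchOut x≢y)) (punchIn x z)
  same z with punchIn x z ≟ y
  ... | yes q = trans (cong (G x) q) (trans e (sym (trans (cong₂ G (punchIn-punchOut x≢y) q) (i y))))
  ... | no q  = trans (h _ (punchInᵢ≢i x z) q) (cong (λ u → G u (punchIn x z)) (sym (punchIn-punchOut x≢y)))

-- An intermediate stage of contracting the leaves of a rank decomposition: labels may sit at
-- inner nodes, but then such a node has lost at least one of its three edges.
record Layout {t n} (T : Adj t) (G : Adj n) (L : Fin n → Fin t) : Set where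
  field
    T-simple    : IsSimple T
    T-connected : Connected T
    T-acyclic   : ¬ HasCycle T
    T-degree    : ∀ v → degree T v ≤ 3
    L-injective : Injective _≡_ _≡_ L
    L-degree    : ∀ x → degree T (L x) ≤ 2
    width       : ∀ u v → T u v ≡ true → Rank1 G (λ x → Walk (removeEdge T u v) u (L x))

module Contract {t} {T : Adj (suc (suc t))} (simpleT : IsSimple T) {v} (leaf : AtMostOneNeighbour T v)
                {w} (edge : T v (punchIn v w) ≡ true) where
  private
    T⁻ = delete T v
    ι  = punchIn v

  -- The contraction of the edge between `v` and `ι w`, as a map on nodes.
  π : Fin (suc (suc t)) → Fin (suc t)
  π u with v ≟ u
  ... | yes _  = w
  ... | no v≢u = punchOut v≢u

  data Position : Fin (suc (suc t)) → Set where
    tip  : Position v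
    rest : ∀ u → Position (ι u)

  position : ∀ u → Position u
  position u with v ≟ u
  ... | yes refl = tip
  ... | no v≢u   = subst Position (punchIn-punchOut v≢u) (rest (punchOut v≢u))

  π-tip : π v ≡ w
  π-tip with v ≟ v
  ... | yes _  = refl
  ... | no v≢v = ⊥-elim (v≢v refl)

  π-rest : ∀ u → π (ι u) ≡ u
  π-rest u with v ≟ ι u
  ... | yes q  = ⊥-elim (punchInᵢ≢i v u (sym q))
  ... | no v≢u = punchIn-injective v _ _ (punchIn-punchOut v≢u)

  π-fibres : ∀ a b → π a ≡ π b → a ≡ b ⊎ (a ≡ v × b ≡ ι w) ⊎ (a ≡ ι w × b ≡ v)
  π-fibres a b q with position a | position b
  ... | tip    | tip    = inj₁ refl
  ... | tip    | rest u = inj₂ (inj₁ (refl , cong ι (trans (sym (π-rest u)) (trans (sym q) π-tip))))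
  ... | rest u | tip    = inj₂ (inj₂ (cong ι (trans (sym (π-rest u)) (trans q π-tip)) , refl))
  ... | rest u | rest z = inj₁ (cong ι (trans (sym (π-rest u)) (trans q (π-rest z))))

  tip-nbr : ∀ {u} → T v u ≡ true → u ≡ ι w
  tip-nbr e = leaf _ _ e edge

  edge′ : T (ι w) v ≡ true
  edge′ = trans (proj₁ simpleT (ι w) v) edge

  π-edge : ∀ {B : Adj (suc (suc t))} {C : Adj (suc t)} → (∀ a b → B a b ≡ true → T a b ≡ true) →
           (∀ a b → B (ι a) (ι b) ≡ true → C a b ≡ true) →
           ∀ a b → B a b ≡ true → C (π a) (π b) ≡ true ⊎ π a ≡ π b
  π-edge {B} {C} sub h a b e with position a | position b
  ... | tip    | _ = inj₂ (trans π-tip (trans (sym (π-rest w)) (cong π (sym (tip-nbr (sub _ _ e))))))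
  ... | rest u | tip =
    inj₂ (trans (cong π (tip-nbr (trans (proj₁ simpleT v (ι u)) (sub _ _ e)))) (trans (π-rest w) (sym π-tip)))
  ... | rest u | rest z = inj₁ (subst₂ (λ a b → C a b ≡ true) (sym (π-rest u)) (sym (π-rest z)) (h u z e))

  degree-w : suc (degree T⁻ w) ≡ degree T (ι w)
  degree-w = sym (count-hit (T (ι w)) v edge′)

  removeEdge-delete : ∀ u z a b → removeEdge T (ι u) (ι z) (ι a) (ι b) ≡ removeEdge T⁻ u z a b
  removeEdge-delete u z a b
    rewrite does-≟-injective ι (λ {a} {b} → punchIn-injective v a b) a u
          | does-≟-injective ι (λ {a} {b} → punchIn-injective v a b) b z
          | does-≟-injective ι (λ {a} {b} → punchIn-injective v a b) a z
          | does-≟-injective ι (λ {a} {b} → punchIn-injective v a b) b u = refl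

  -- An edge of `T⁻` cuts the kept labels as it did in `T`, since `v` lies on the side of `ι w`. The
  -- node `w` may receive the label of `v`; it has degree at most 2 because it has lost the edge to
  -- `v`.
  contract : ∀ {n k} {G : Adj n} {L : Fin n → Fin (suc (suc t))} → Layout T G L →
             (j : Fin k → Fin n) → Injective _≡_ _≡_ j → Injective _≡_ _≡_ (π ∘ L ∘ j) →
             Layout T⁻ (λ a b → G (j a) (j b)) (π ∘ L ∘ j)
  contract {G = G} {L} lay j j-inj inj = record
    { T-simple    = delete-simple simpleT v
    ; T-connected = λ a b → subst₂ (Walk T⁻) (π-rest a) (π-rest b)
                      (walk-map π (π-edge (λ _ _ e → e) (λ _ _ e → e)) (T-connected (ι a) (ι b)))
    ; T-acyclic   = delete-acyclic {A = T} v T-acyclic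
    ; T-degree    = λ u → ℕ.≤-trans (degree-delete T v u) (T-degree (ι u))
    ; L-injective = inj
    ; L-degree    = λ x → deg (L (j x)) (position (L (j x))) (L-degree (j x))
    ; width       = wid
    }
    where
    open Layout lay
    deg : ∀ u → Position u → degree T u ≤ 2 → degree T⁻ (π u) ≤ 2
    deg _ tip      _ rewrite π-tip = s≤s⁻¹ (ℕ.≤-trans (ℕ.≤-reflexive degree-w) (T-degree (ι w)))
    deg _ (rest u) d rewrite π-rest u = ℕ.≤-trans (degree-delete T v u) d
    module Cut (u z : Fin (suc t)) where
      C = removeEdge T⁻ u z
      B = removeEdge T (ι u) (ι z)
      down : ∀ {p} → Walk B (ι u) p → Walk C u (π p)
      down walk = subst (λ s → Walk C s _) (π-rest u)
        (walk-map π (π-edge {B = B} {C = C} (removeEdge-⊆ T (ι u) (ι z))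
                            (λ a b e → trans (sym (removeEdge-delete u z a b)) e)) walk)
      lift : ∀ {p} → Walk C u p → Walk B (ι u) (ι p)
      lift = walk-map ι (λ a b e → inj₁ (trans (removeEdge-delete u z a b) e))
      up : ∀ p → Position p → Walk C u (π p) → Walk B (ι u) p
      up _ tip walk rewrite π-tip = walk-snoc (lift walk)
        (removeEdge-keeps T (ι u) (ι z) edge′ (λ (_ , q) → punchInᵢ≢i v z (sym q)) (λ (_ , q) → punchInᵢ≢i v u (sym q)))
      up _ (rest p) walk rewrite π-rest p = lift walk
    wid : ∀ u z → T⁻ u z ≡ true → Rank1 (λ a b → G (j a) (j b)) (λ x → Walk (removeEdge T⁻ u z) u (π (L (j x))))
    wid u z e {a} {b} a≢b xa xb
      with c , d , nz , dep ← width (ι u) (ι z) e (a≢b ∘ j-inj) (Cut.up u z _ (position _) xa) (Cut.up u z _ (position _) xb)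
      = c , d , nz , λ y ¬xy → dep (j y) (¬xy ∘ Cut.down u z)

LayoutBuilt : ℕ → Set
LayoutBuilt t = ∀ {T : Adj t} {n} {G : Adj n} {L : Fin n → Fin t} →
                IsSimple G → Bipartite G → Layout T G L → Built G

module LayoutStep {t} (ih : LayoutBuilt (suc t)) {T : Adj (suc (suc t))} {n} {G : Adj (suc n)}
                  {L : Fin (suc n) → Fin (suc (suc t))}
                  (si : IsSimple G) (bip : Bipartite G) (lay : Layout T G L) {v} (leaf : AtMostOneNeighbour T v)
                  {w} (edge : T v (punchIn v w) ≡ true) where
  open Layout lay
  private
    ι = punchIn v
  open Contract {T = T} T-simple {v} leaf {w} edge

  -- Contraction merges only `v` and `ι w`, so the labels stay distinct unless both nodes carry one.
  recurse : ∀ {k} (j : Fin k → Fin (suc n)) → Injective _≡_ _≡_ j →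
            ¬ ((∃ λ x → L (j x) ≡ v) × (∃ λ y → L (j y) ≡ ι w)) → Built (λ a b → G (j a) (j b))
  recurse j j-inj h = ih {delete T v} {G = λ a b → G (j a) (j b)} {π ∘ L ∘ j} ((λ _ _ → proj₁ si _ _) , λ _ → proj₂ si _)
    (proj₁ bip ∘ j , λ _ _ → proj₂ bip _ _) (contract lay j j-inj inj)
    where
    inj : Injective _≡_ _≡_ (π ∘ L ∘ j)
    inj {a} {b} q with π-fibres (L (j a)) (L (j b)) q
    ... | inj₁ r              = j-inj (L-injective r)
    ... | inj₂ (inj₁ (r , s)) = ⊥-elim (h ((a , r) , (b , s)))
    ... | inj₂ (inj₂ (r , s)) = ⊥-elim (h ((b , s) , (a , r)))

  module Siblings {x y} (Lx : L x ≡ v) (Ly : L y ≡ ι w) where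
    x≢y : x ≢ y
    x≢y q = punchInᵢ≢i v w (trans (sym Ly) (trans (cong L (sym q)) Lx))

    without-x : Built (delete G x)
    without-x = recurse (punchIn x) (punchIn-injective x _ _)
      λ ((a , q) , _) → punchInᵢ≢i x a (L-injective (trans q (sym Lx)))

    without-y : Built (delete G y)
    without-y = recurse (punchIn y) (punchIn-injective y _ _)
      λ (_ , (a , q)) → punchInᵢ≢i y a (L-injective (trans q (sym Ly)))

    Near : Fin (suc (suc t)) → Set
    Near u = u ≡ v ⊎ u ≡ ι w

    near-label : ∀ z → Near (L z) → z ≢ x → z ≢ y → ⊥
    near-label z (inj₁ q) z≢x _ = z≢x (L-injective (trans q (sym Lx)))
    near-label z (inj₂ q) _ z≢y = z≢y (L-injective (trans q (sym Ly)))

    -- With a further neighbour `ι u`, the edge from `ι w` to it separates exactly `x` and `y` from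
    -- the other labels, and the rank condition relates their rows. A single nonzero coefficient
    -- makes that vertex isolated or pendant at the other one; two of them make `x` and `y` twins.
    result : Dec (∃ λ u → T (ι w) (ι u) ≡ true) → Built G
    -- Here `v` and `ι w` are the whole tree, so `x` and `y` are the only vertices of `G`.
    result (no none) = attach-at-most-pendant si x≢y
      (λ z z≢x z≢y → ⊥-elim (near-label z (walk-closed Near closed (inj₁ refl) (T-connected v (L z))) z≢x z≢y))
      without-x
      where
      closed : ∀ {a b} → Near a → T a b ≡ true → Near b
      closed (inj₁ refl) e = inj₂ (tip-nbr e)
      closed {b = b} (inj₂ refl) e with position b
      ... | tip    = inj₁ refl
      ... | rest u = ⊥-elim (none (u , e))
    result (yes (u , e)) = conclude (width (ι w) (ι u) e x≢y X-x X-y)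
      where
      B = removeEdge T (ι w) (ι u)
      X : Fin (suc n) → Set
      X z = Walk B (ι w) (L z)
      X-x : X x
      X-x = subst (Walk B (ι w)) (sym Lx) (step
        (removeEdge-keeps T (ι w) (ι u) edge′ (λ (_ , q) → punchInᵢ≢i v u (sym q)) (λ (_ , q) → punchInᵢ≢i v w (sym q))) here)
      X-y : X y
      X-y = subst (Walk B (ι w)) (sym Ly) here
      closed : ∀ {a b} → Near a → B a b ≡ true → Near b
      closed {b = b} (inj₁ refl) f = inj₂ (tip-nbr (removeEdge-⊆ T (ι w) (ι u) _ b f))
      closed {b = b} (inj₂ refl) f with position b
      ... | tip    = inj₁ refl
      ... | rest z with z ≟ u
      ...   | yes refl = ⊥-elim (removeEdge-removed T (ι w) (ι u) f)
      -- A third neighbour `ι z` besides `v` and `ι u` would give the labelled node `ι w` degree 3.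
      ...   | no z≢u   = ⊥-elim (ℕ.<-irrefl refl (ℕ.≤-trans three (subst (λ s → degree T s ≤ 2) Ly (L-degree y))))
        where
        three : 3 ≤ degree T (ι w)
        three = ℕ.≤-trans (s≤s (count-two (delete T v w) z≢u (removeEdge-⊆ T (ι w) (ι u) (ι w) (ι z) f) e))
                          (ℕ.≤-reflexive degree-w)
      outside : ∀ z → z ≢ x → z ≢ y → ¬ X z
      outside z z≢x z≢y walk = near-label z (walk-closed Near closed (inj₂ refl) walk) z≢x z≢y
      xor-false : ∀ p q → p xor q ≡ false → p ≡ q
      xor-false false false _ = refl
      xor-false true  true  _ = refl
      conclude : (Σ Bool λ c → Σ Bool λ d → c ∨ d ≡ true × (∀ z → ¬ X z → (c ∧ G x z) xor (d ∧ G y z) ≡ false)) →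
                 Built G
      conclude (true , false , _ , dep) = attach-at-most-pendant si x≢y
        (λ z z≢x z≢y → trans (sym (Bool.xor-identityʳ _)) (dep z (outside z z≢x z≢y))) without-x
      conclude (false , true , _ , dep) = attach-at-most-pendant si (x≢y ∘ sym)
        (λ z z≢y z≢x → dep z (outside z z≢x z≢y)) without-y
      conclude (true , true , _ , dep) = attach-twin si bip x≢y
        (λ z z≢x z≢y → xor-false _ _ (dep z (outside z z≢x z≢y))) without-x

  built : Built G
  built = go (any? (λ x → L x ≟ v)) (any? (λ y → L y ≟ ι w))
    where
    go : Dec (∃ λ x → L x ≡ v) → Dec (∃ λ y → L y ≡ ι w) → Built G
    go (no h)         _              = recurse id id (h ∘ proj₁)
    go (yes _)        (no h)         = recurse id id (h ∘ proj₂)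
    go (yes (x , Lx)) (yes (y , Ly)) = Siblings.result Lx Ly (any? (λ u → T (ι w) (ι u) Bool.≟ true))

connected-neighbour : ∀ {T : Adj n} {v z} → Walk T v z → z ≢ v → ∃ λ w → T v w ≡ true
connected-neighbour here       z≢v = ⊥-elim (z≢v refl)
connected-neighbour (step e _) _   = _ , e

layout-step : ∀ {t} → LayoutBuilt (suc t) → LayoutBuilt (suc (suc t))
layout-step _  {n = zero} si _ _ = small z≤n si
layout-step ih {T} {suc n} si bip lay
  with v , leaf ← acyclic-leaf (Layout.T-simple lay) (Layout.T-acyclic lay)
  with u , e ← connected-neighbour (Layout.T-connected lay v (punchIn v zero)) (punchInᵢ≢i v zero)
  = LayoutStep.built ih si bip lay leaf {punchOut v≢u}
      (subst (λ u → T v u ≡ true) (sym (punchIn-punchOut v≢u)) e)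
  where v≢u = ≢-adjacent (Layout.T-simple lay) e

layout-built : ∀ t → LayoutBuilt t
layout-built zero {n = zero}  si _ _ = small z≤n si
layout-built zero {n = suc n} {L = L} si _ _ with () ← L zero
layout-built (suc zero) si _ lay = small (injective⇒≤ (Layout.L-injective lay)) si
layout-built (suc (suc t)) = layout-step (layout-built (suc t))

rankWidth-built : ∀ {G : Adj n} → IsSimple G → Bipartite G → RankWidthAtMost G 1 → Built G
rankWidth-built si bip (inj₁ n≤1) = small n≤1 si
rankWidth-built {G = G} si bip (inj₂ (D , w)) = layout-built t si bip record
  { T-simple = proj₁ tree ; T-connected = proj₁ (proj₂ tree) ; T-acyclic = proj₂ (proj₂ tree)
  ; T-degree = deg
  ; L-injective = L-inj
  ; L-degree = λ x → ℕ.≤-trans (ℕ.≤-reflexive (L-leaf x)) (s≤s z≤n)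
  ; width = λ u v e → cutRank⇒Rank1 (w u v e) }
  where
  open RankDecomposition D
  tree = proj₁ (proj₂ subcubic)
  deg : ∀ v → degree T v ≤ 3
  deg v with degree T v ℕ.≟ 1
  ... | yes q = ℕ.≤-trans (ℕ.≤-reflexive q) (s≤s z≤n)
  ... | no q  = ℕ.≤-reflexive (proj₂ (proj₂ subcubic) v q)

-- From built graphs to trees

-- An isomorphism is recorded only at the end of a sequence of operations, so one of the host graph
-- is pushed through every step.
pm-isoʳ : ∀ {l} {G : Adj l} {H : Adj m} {K : Adj n} → PivotMinor G H → Iso H K → PivotMinor G K
pm-isoʳ {H = H} {K} (pm-iso ψ) φ = pm-iso (Iso-trans {B = H} {C = K} ψ φ)
pm-isoʳ {n = zero} (pm-del v p) (f , _) with () ← f ⟨$⟩ʳ v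
pm-isoʳ {n = suc n} {H = H} {K} (pm-del v p) φ@(f , _) =
  pm-del (f ⟨$⟩ʳ v) (pm-isoʳ p (delete-Iso {G = H} {H = K} φ v))
pm-isoʳ {H = H} {K} (pm-piv u v e p) (f , q) =
  pm-piv (f ⟨$⟩ʳ u) (f ⟨$⟩ʳ v) (trans (sym (q u v)) e)
    (pm-isoʳ {K = pivot K (f ⟨$⟩ʳ u) (f ⟨$⟩ʳ v)} p (f , pivot-preserves f {H} {K} q u v))

pm-≈ : ∀ {l} {G : Adj l} {H K : Adj n} → PivotMinor G H → H ≈ K → PivotMinor G K
pm-≈ p q = pm-isoʳ p (≈⇒Iso q)

pm-isoˡ : ∀ {l} {G : Adj l} {H : Adj m} {K : Adj n} → Iso G H → PivotMinor H K → PivotMinor G K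
pm-isoˡ {H = H} {K} φ (pm-iso ψ) = pm-iso (Iso-trans {B = H} {C = K} φ ψ)
pm-isoˡ φ (pm-del v p)     = pm-del v (pm-isoˡ φ p)
pm-isoˡ φ (pm-piv u v e p) = pm-piv u v e (pm-isoˡ φ p)

pm-trans : ∀ {l} {G : Adj l} {H : Adj m} {K : Adj n} → PivotMinor G H → PivotMinor H K → PivotMinor G K
pm-trans p (pm-iso φ)       = pm-isoʳ p φ
pm-trans p (pm-del v q)     = pm-del v (pm-trans p q)
pm-trans p (pm-piv u v e q) = pm-piv u v e (pm-trans p q)

pivoted-involutive : ∀ (u v y : Fin n) c → pivoted u v y (pivoted u v y c) ≡ c
pivoted-involutive u v y c with onEdge u v y
... | true  = refl
... | false = refl

-- The same operations are carried out next to an added vertex. Deletions keep its coefficients and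
-- pivots at most swap them; as the swap is an involution, the coefficients needed in `K` are found
-- backwards from `c`.
pm-extend : ∀ {H : Adj m} {K : Adj n} → IsSimple K → PivotMinor H K → ∀ y c → proj₁ c ∧ proj₂ c ≡ false →
            Σ (Fin n) λ y′ → Σ (Bool × Bool) λ c′ →
            proj₁ c′ ∧ proj₂ c′ ≡ false × PivotMinor (extend H y c) (extend K y′ c′)
pm-extend {H = H} {K} si (pm-iso φ) y c ok = proj₁ φ ⟨$⟩ʳ y , c , ok , pm-iso (extend-Iso {H = H} {K = K} φ y c)
pm-extend {K = K} si (pm-del v p) y c ok with pm-extend (delete-simple si v) p y c ok
... | y′ , c′ , ok′ , q =
  punchIn v y′ , c′ , ok′ , pm-del (suc v) (pm-≈ q (≈-sym (delete-extend K v refl c′)))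
pm-extend {K = K} si (pm-piv u v e p) y c ok with pm-extend (pivot-simple si u v) p y c ok
... | y′ , c′ , ok′ , q =
  y′ , c″ , pivoted-ok u v y′ c′ ok′ , pm-piv (suc u) (suc v) e (pm-≈ q (≈-sym back))
  where
  c″ = pivoted u v y′ c′
  back : pivot (extend K y′ c″) (suc u) (suc v) ≈ extend (pivot K u v) y′ c′
  back = subst (λ d → pivot (extend K y′ c″) (suc u) (suc v) ≈ extend (pivot K u v) y′ d)
           (pivoted-involutive u v y′ c′) (pivot-extend si u v e y′ c″)

hangPath : Adj n → Fin n → Adj (suc (suc n))
hangPath K y = extend (extend K y pendant) zero pendant

-- Deleting the middle vertex of the hung path isolates its end.
isolated-in-path : ∀ (K : Adj n) y → PivotMinor (extend K y isolated) (hangPath K y)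
isolated-in-path K y = pm-del (suc zero) (pm-iso (≈⇒Iso {B = delete (hangPath K y) (suc zero)}
  λ { zero zero → refl ; zero (suc b) → refl ; (suc a) zero → refl ; (suc a) (suc b) → refl }))

-- Let y, a, x be the hung path. Pivoting ya makes x a twin of a and exchanges y with a, so that a
-- takes the place of y once y is deleted.
twin-in-path : ∀ {K : Adj (suc n)} → IsSimple K → ∀ y → PivotMinor (extend K y twin) (hangPath K y)
twin-in-path {n} {K} si y =
  pm-piv (suc (suc y)) (suc zero) (pendant-row-self K y) (pm-del (suc (suc y))
    (pm-≈ (pm-iso (Iso-sym {A = extend M⁻ zero twin} twins)) (≈-sym pivoted-path)))
  where
  K₁ = extend K y pendant
  M  = pivot K₁ (suc y) zero
  M⁻ = delete M (suc y)
  pivoted-path : delete (pivot (hangPath K y) (suc (suc y)) (suc zero)) (suc (suc y)) ≈ extend M⁻ zero twin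
  pivoted-path = ≈-trans
    (λ a b → pivot-extend (add-simple si (row K y pendant)) (suc y) zero (pendant-row-self K y) zero pendant
               (punchIn (suc (suc y)) a) (punchIn (suc (suc y)) b))
    (delete-extend M (suc y) {y′ = zero} refl twin)
  -- With the deleted position `p` abstracted, its equation can be matched on, and `delete K₁ p`
  -- becomes `K`.
  replace : ∀ p → p ≡ zero → (φ : Iso M⁻ (delete K₁ p)) → suc y ≡ punchIn p (proj₁ φ ⟨$⟩ʳ zero) →
            Σ (Iso M⁻ K) λ ψ → proj₁ ψ ⟨$⟩ʳ zero ≡ y
  replace _ refl φ q = φ , sym (suc-injective q)
  f = exchangeₚ y
  a-for-y : Σ (Iso M⁻ K) λ ψ → proj₁ ψ ⟨$⟩ʳ zero ≡ y
  a-for-y = replace (f ⟨$⟩ʳ suc y) (exchange-hit y) (delete-Iso {G = M} {H = K₁} (f , pendant-pivot′ si y) (suc y))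
              (punchIn-permute f (suc y) zero)
  twins : Iso (extend M⁻ zero twin) (extend K y twin)
  twins = subst (λ z → Iso (extend M⁻ zero twin) (extend K z twin)) (proj₂ a-for-y)
            (extend-Iso {H = M⁻} {K = K} (proj₁ a-for-y) zero twin)

PivotMinorOfTree : Adj n → Set
PivotMinorOfTree G = Σ ℕ (λ m → Σ (Adj (suc m)) (λ T → IsTree T × PivotMinor G T))

extended-tree : ∀ {T : Adj (suc n)} → IsTree T → ∀ y c → proj₁ c ∧ proj₂ c ≡ false → PivotMinorOfTree (extend T y c)
extended-tree {T = T} tree y (true , false) _ =
  _ , extend T y pendant , hang-tree tree y , pm-iso (≈⇒Iso λ _ _ → refl)
extended-tree {T = T} tree y (false , d) _ =
  _ , hangPath T y , hang-tree (hang-tree tree y) zero , go d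
  where
  go : ∀ d → PivotMinor (extend T y (false , d)) (hangPath T y)
  go false = isolated-in-path T y
  go true  = twin-in-path (proj₁ tree) y

built-tree : ∀ {G : Adj n} → Built G → PivotMinorOfTree G
-- A tree has at least one vertex, so the empty graph costs a deletion.
built-tree (small z≤n _) = 0 , point , point-tree , pm-del zero (pm-iso (Perm.id , λ ()))
built-tree (small (s≤s z≤n) (_ , i)) = 0 , point , point-tree , pm-iso (Perm.id , λ { zero zero → i zero })
built-tree (relabel φ b) with m , T , tree , p ← built-tree b = m , T , tree , pm-isoˡ φ p
built-tree (grow b y c ok)
  with m , T , tree , p ← built-tree b
  with y′ , c′ , ok′ , q ← pm-extend (proj₁ tree) p y c ok
  with m′ , T′ , tree′ , q′ ← extended-tree tree y′ c′ ok′
  = m′ , T′ , tree′ , pm-trans q q′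

theorem4p5 : ∀ (n : ℕ) (G : Adj n) → IsSimple G →
    ((Bipartite G × RankWidthAtMost G 1) ⇔
    Σ ℕ (λ m → Σ (Adj (suc m)) (λ T → IsTree T × PivotMinor G T)))
theorem4p5 n G si = mk⇔
  (λ (bip , rw) → built-tree (rankWidth-built si bip rw))
  (λ (m , T , (T-simple , _ , acyclic) , p) →
    let b = built-pivotMinor p (acyclic-built T-simple acyclic) in built-bipartite b , built-rankWidth b)
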